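{- Let $n\ge 2$ and let $X$ be a $\mathcal D$-subspace of $\mathbb P=PG(\mathbb E,\mathbb{F}_q)=PG(n^2-1,q)$. Then there exist two Desarguesian $(n-1)$-spreads $\mathcal D_1(X)$ and $\mathcal D_2(X)$ of $\mathbb P$ such that: (D1) $X\in\mathcal D_i(X)$ and $\mathcal R_i\subset\mathcal D_i(X)$ for $i=1,2$; (D2) for $i=1,2$ there is a linear collineation $\Xi_i$ of $\mathbb P$ fixing $\mathcal D_i(X)$ which induces a semilinear collineation $\tilde\Xi_i$ of order $n$ of $\Pi_{n-1}(\mathcal D_i(X))\cong PG(n-1,q^n)$ whose set of fixed points is exactly $\mathcal R_i$, and $\mathcal R_i$ is a subgeometry of $\Pi_{n-1}(\mathcal D_i(X))$ isomorphic to $PG(n-1,q)$. Moreover there exists an involutory collineation $\Phi$ of $\mathbb P$ such that (D3) $\Phi$ fixes $X$ pointwise, and (D4) $\mathcal D_1(X)^\Phi=\mathcal D_2(X)$.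
   Context: $\mathbb E=\mathrm{End}(\mathbb{F}_{q^n},\mathbb{F}_q)$; $\langle\varphi\rangle_q$ is the point of $\mathbb P$ defined by $\varphi\ne0$; $t_\lambda:x\mapsto\lambda x$. The Segre variety $\mathcal S_{n,n}$ is the set of points $\langle\varphi\rangle_q$ with $\varphi$ of rank 1; its maximal subspaces are $(n-1)$-dimensional and form two systems $\mathcal R_1,\mathcal R_2$, where $\mathcal R_1=\{\{\langle t_\alpha\circ\mathrm{Tr}\circ t_\lambda\rangle_q:\alpha\in\mathbb{F}_{q^n}^*\}:\lambda\in\mathbb{F}_{q^n}^*\}$ and $\mathcal R_2=\{\{\langle t_\lambda\circ\mathrm{Tr}\circ t_\alpha\rangle_q:\alpha\in\mathbb{F}_{q^n}^*\}:\lambda\in\mathbb{F}_{q^n}^*\}$, $\mathrm{Tr}$ the trace $\mathbb{F}_{q^n}\to\mathbb{F}_q$. $H(\mathcal S_{n,n})$ is the subgroup of $PGL(n^2,q)$ fixing each of $\mathcal R_1$ and $\mathcal R_2$. Let $\mathcal I=\{\langle t_\lambda\rangle_q:\lambda\in\mathbb{F}_{q^n}^*\}$, an $(n-1)$-dimensional subspace of $\mathbb P$; a $\mathcal D$-subspace of $\mathbb P$ is any subspace in the orbit of $\mathcal I$ under $H(\mathcal S_{n,n})$. An $(n-1)$-spread of $\mathbb P$ is a partition of its points into $(n-1)$-dimensional subspaces; it is Desarguesian if it arises as the set of subspaces $\{\langle\mathbf v\rangle_{q^n}\}$ viewed over $\mathbb F_q$ when the underlying $\mathbb F_q$-space is endowed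 with an $\mathbb F_{q^n}$-vector space structure. For a Desarguesian $(n-1)$-spread $\mathcal D$ of $\mathbb P$, $\Pi_{n-1}(\mathcal D)$ is the projective space $\cong PG(n-1,q^n)$ whose points are the elements of $\mathcal D$ and whose subspaces are the sets of spread elements contained in subspaces of $\mathbb P$ spanned by spread elements. A subgeometry isomorphic to $PG(n-1,q)$ of $PG(n-1,q^n)$ is the point set defined by an $\mathbb F_q$-subspace of dimension $n$ spanning the underlying $\mathbb F_{q^n}$-space. -}

module Defs where

open import Algebra.Apartness.Bundles using (HeytingCommutativeRing; HeytingField)
open import Algebra.Bundles using (CommutativeRing; Ring)
open import Algebra.Module.Bundles using (LeftModule)
open import Algebra.Module.Morphism.Structures using (module LeftModuleMorphisms)
open import Algebra.Module.Structures using (IsLeftModule)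
open import Algebra.Morphism.Structures using (module GroupMorphisms; module RingMorphisms)
import Algebra.Properties.Semiring.Exp as Exp
import Algebra.Properties.CommutativeSemigroup as CommutativeSemigroupProperties
import Algebra.Properties.CommutativeMonoid.Sum as Sum
import Algebra.Properties.Ring as RingProperties
open import Data.Fin using (Fin; toℕ)
open import Data.Nat using (ℕ; _<_; _^_)
open import Data.Nat.GeneralisedArithmetic using (iterate)
open import Data.Product using (Σ; Σ-syntax; ∃; ∃-syntax; _×_; _,_; proj₁; proj₂)
open import Data.Vec.Functional using (Vector)
open import Function using (_∘_; _⇔_; Inverse)
open import Level using (Level; _⊔_; suc)
open import Relation.Binary using (Setoid)
open import Relation.Binary.PropositionalEquality as ≡ using ()
open import Relation.Nullary using (¬_)
open import Relation.Unary using (Pred; _∈_; _⊆_; _≐_; ⋃)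
import Relation.Binary.Reasoning.Setoid as SetoidReasoning

fieldRing : {ℓ : Level} → HeytingField ℓ ℓ ℓ → Ring ℓ ℓ
fieldRing L = CommutativeRing.ring (HeytingCommutativeRing.commutativeRing
  (HeytingField.heytingCommutativeRing L))

VectorSpace : {ℓ : Level} → HeytingField ℓ ℓ ℓ → Set (suc ℓ)
VectorSpace {ℓ} L = LeftModule (fieldRing L) ℓ ℓ

HasSize : {ℓ : Level} → Setoid ℓ ℓ → ℕ → Set ℓ
HasSize S m = Inverse S (≡.setoid (Fin m))

record Geometry (c ℓ : Level) : Set (suc (c ⊔ ℓ)) where
  field
    points     : Setoid c ℓ
    IsSubspace : Pred (Pred (Setoid.Carrier points) ℓ) (c ⊔ ℓ)

  open Setoid points public renaming (Carrier to Point)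

-- The image of a point set T under the bijection `to` is written T ∘ from.

record Isomorphism {c d ℓ : Level} (𝒢 : Geometry c ℓ) (ℋ : Geometry d ℓ) :
                   Set (c ⊔ d ⊔ suc ℓ) where
  private
    module 𝒢 = Geometry 𝒢
    module ℋ = Geometry ℋ
  field
    bijection : Inverse 𝒢.points ℋ.points

  open Inverse bijection public using (to; from)

  field
    to-subspace   : ∀ {T} → 𝒢.IsSubspace T → ℋ.IsSubspace (T ∘ from)
    from-subspace : ∀ {T} → ℋ.IsSubspace T → 𝒢.IsSubspace (T ∘ to)

Collineation : {c ℓ : Level} → Geometry c ℓ → Set (c ⊔ suc ℓ)
Collineation 𝒢 = Isomorphism 𝒢 𝒢

module _ {c ℓ : Level} {𝒢 : Geometry c ℓ} where
  open Geometry 𝒢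

  infix 10 _⟦_⟧
  _⟦_⟧ : Collineation 𝒢 → Pred Point ℓ → Pred Point ℓ
  κ ⟦ T ⟧ = T ∘ Isomorphism.from κ

  -- 𝒜 ^ κ = ℬ, as families of point sets
  MapsFamily : Collineation 𝒢 → (𝒜 ℬ : Pred (Pred Point ℓ) ℓ) → Set (c ⊔ suc ℓ)
  MapsFamily κ 𝒜 ℬ =
    (∀ {S} → S ∈ 𝒜 → κ ⟦ S ⟧ ∈ ℬ) ×
    (∀ {T} → T ∈ ℬ → ∃[ S ] S ∈ 𝒜 × T ≐ κ ⟦ S ⟧)

  PowerIsIdentity : Collineation 𝒢 → ℕ → Set (c ⊔ ℓ)
  PowerIsIdentity κ m = ∀ p → iterate (Isomorphism.to κ) p m ≈ p

  HasOrder : Collineation 𝒢 → ℕ → Set (c ⊔ ℓ)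
  HasOrder κ m =
    0 < m × PowerIsIdentity κ m × (∀ k → 0 < k → k < m → ¬ PowerIsIdentity κ k)

module Projective {ℓ : Level} (L : HeytingField ℓ ℓ ℓ) (V : VectorSpace L) where

  open HeytingField L using (0#) renaming (Carrier to Scalar; _≈_ to _≈ˢ_)
  open LeftModule V
  open Sum +ᴹ-commutativeMonoid using (sum)

  combination : ∀ {m} → Vector Scalar m → Vector Carrierᴹ m → Carrierᴹ
  combination a b = sum (λ i → a i *ₗ b i)

  InSpan : ∀ {m} → Vector Carrierᴹ m → Pred Carrierᴹ ℓ
  InSpan b v = ∃[ a ] v ≈ᴹ combination a b

  LinearlyIndependent : ∀ {m} → Vector Carrierᴹ m → Set ℓ
  LinearlyIndependent b = ∀ a → combination a b ≈ᴹ 0ᴹ → ∀ i → a i ≈ˢ 0#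

  HasDimension : ℕ → Set ℓ
  HasDimension m = Σ[ b ∈ Vector Carrierᴹ m ] LinearlyIndependent b × (∀ v → InSpan b v)

  Point : Set ℓ
  Point = Σ[ v ∈ Carrierᴹ ] ¬ v ≈ᴹ 0ᴹ

  PointSet : Set (suc ℓ)
  PointSet = Pred Point ℓ

  -- ⟨ v ⟩ = ⟨ w ⟩, by mutual inclusion
  infix 4 _∼_
  _∼_ : Point → Point → Set ℓ
  (v , _) ∼ (w , _) = (∃[ a ] v ≈ᴹ a *ₗ w) × (∃[ b ] w ≈ᴹ b *ₗ v)

  pointSetoid : Setoid ℓ ℓ
  pointSetoid = record
    { Carrier       = Point
    ; _≈_           = _∼_
    ; isEquivalence = record
      { refl  = (_ , reflexive) , (_ , reflexive)
      ; sym   = λ (p , q) → q , p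
      ; trans = λ (p , p′) (q , q′) → transitive p q , transitive q′ p′
      }
    }
    where
    reflexive : ∀ {v} → v ≈ᴹ HeytingField.1# L *ₗ v
    reflexive = ≈ᴹ-sym (*ₗ-identityˡ _)

    transitive : ∀ {u v w} → (∃[ a ] u ≈ᴹ a *ₗ v) → (∃[ a ] v ≈ᴹ a *ₗ w) →
                 ∃[ a ] u ≈ᴹ a *ₗ w
    transitive (_ , p) (_ , q) =
      _ , ≈ᴹ-trans p (≈ᴹ-trans (*ₗ-congˡ q) (≈ᴹ-sym (*ₗ-assoc _ _ _)))

  pointsOf : Pred Carrierᴹ ℓ → PointSet
  pointsOf W (v , _) = v ∈ W

  -- Subspaces are given by finite spanning families: no loss for
  -- finite-dimensional V, and constructively it rules out undecidable ones.
  -- The empty subspace is included.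
  PG : Geometry ℓ ℓ
  PG = record
    { points     = pointSetoid
    ; IsSubspace = λ T → ∃[ m ] Σ[ b ∈ Vector Point m ] T ≐ pointsOf (InSpan (proj₁ ∘ b))
    }

  -- a subspace of projective dimension r - 1
  IsSubspaceOfRank : ℕ → Pred PointSet ℓ
  IsSubspaceOfRank r S =
    Σ[ b ∈ Vector Carrierᴹ r ] LinearlyIndependent b × S ≐ pointsOf (InSpan b)

  SpannedBy : PointSet → PointSet
  SpannedBy T p = ∃[ m ] Σ[ b ∈ Vector Point m ]
    (∀ i → b i ∈ T) × p ∈ pointsOf (InSpan (proj₁ ∘ b))

  IsSpread : ℕ → Pred (Pred PointSet ℓ) (suc ℓ)
  IsSpread r 𝒟 =
    (∀ {S} → S ∈ 𝒟 → IsSubspaceOfRank r S) ×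
    (∀ p → ∃[ S ] S ∈ 𝒟 × p ∈ S) ×
    (∀ {S T p} → S ∈ 𝒟 → T ∈ 𝒟 → p ∈ S → p ∈ T → S ≐ T)

  open LeftModuleMorphisms rawLeftModule rawLeftModule

  -- membership in PGL(V); the scalar c below is automatically nonzero
  IsLinear : Collineation PG → Set ℓ
  IsLinear κ = Σ[ f ∈ (Carrierᴹ → Carrierᴹ) ] IsLeftModuleIsomorphism f ×
    (∀ p → ∃[ c ] proj₁ (Isomorphism.to κ p) ≈ᴹ c *ₗ f (proj₁ p))

-- F_q ⊆ F_{q^n}, the inclusion being the (automatically injective) ι; the
-- cardinalities force [𝔽 : 𝕂] = n.  Finiteness makes equality decidable and
-- the apartness of each field equivalent to inequality.
record FiniteFieldExtension (ℓ : Level) (q n : ℕ) : Set (suc ℓ) where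
  field
    𝕂 𝔽 : HeytingField ℓ ℓ ℓ

  module 𝕂 = Ring (fieldRing 𝕂)
  module 𝔽 = Ring (fieldRing 𝔽)
  open RingMorphisms 𝕂.rawRing 𝔽.rawRing

  field
    𝕂-size : HasSize 𝕂.setoid q
    𝔽-size : HasSize 𝔽.setoid (q ^ n)
    ι      : 𝕂.Carrier → 𝔽.Carrier
    ι-homo : IsRingHomomorphism ι

  module ι = RingMorphisms.IsRingHomomorphism ι-homo

module Desarguesian {ℓ : Level} {q n : ℕ} (ext : FiniteFieldExtension ℓ q n)
                    (V : VectorSpace (FiniteFieldExtension.𝕂 ext)) where

  open FiniteFieldExtension ext
  open LeftModule V
  open Projective 𝕂 V

  -- an 𝔽-vector space structure on V inducing the given 𝕂-structure
  record 𝔽-Structure : Set ℓ where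
    infixr 7 _·_
    field
      _·_             : 𝔽.Carrier → Carrierᴹ → Carrierᴹ
      ·-isLeftModule  : IsLeftModule (fieldRing 𝔽) _≈ᴹ_ _+ᴹ_ 0ᴹ -ᴹ_ _·_
      ·-extends       : ∀ k v → ι k · v ≈ᴹ k *ₗ v

    vectorSpace : VectorSpace 𝔽
    vectorSpace = record { isLeftModule = ·-isLeftModule }

    -- the point set in PG(V,𝕂) of the one-dimensional 𝔽-subspace ⟨ v ⟩
    line : Carrierᴹ → PointSet
    line v = pointsOf (λ w → ∃[ a ] w ≈ᴹ a · v)

  record DesarguesianSpread : Set (suc ℓ) where
    field
      members   : Pred PointSet ℓ
      isSpread  : IsSpread n members
      structure : 𝔽-Structure

    open 𝔽-Structure structure public

    field
      arises : ∀ S → S ∈ members ⇔ (Σ[ v ∈ Point ] S ≐ line (proj₁ v))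

  module _ (𝒟 : DesarguesianSpread) where
    open DesarguesianSpread 𝒟

    -- Π_{n-1}(𝒟); its subspaces are the sets of all members contained in the
    -- subspace of PG(V,𝕂) spanned by finitely many members
    Π : Geometry (suc ℓ) ℓ
    Π = record
      { points = record
        { Carrier       = Σ[ S ∈ PointSet ] S ∈ members
        ; _≈_           = λ S T → proj₁ S ≐ proj₁ T
        ; isEquivalence = record
          { refl  = (λ x → x) , (λ x → x)
          ; sym   = λ (f , g) → g , f
          ; trans = λ (f , g) (f′ , g′) → (λ x → f′ (f x)) , (λ x → g (g′ x))
          }
        }
      ; IsSubspace = λ T → ∃[ m ] Σ[ G ∈ Vector (Σ[ S ∈ PointSet ] S ∈ members) m ]
          T ≐ (λ S → proj₁ S ⊆ SpannedBy (⋃ (Fin m) (λ i → proj₁ (G i))))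
      }

    -- Π ≅ PG(n-1,q^n), the isomorphism being the canonical one ⟨ v ⟩ ↔ v
    IsProjectiveSpace : Set (suc ℓ)
    IsProjectiveSpace =
      Projective.HasDimension 𝔽 vectorSpace n ×
      (Σ[ θ ∈ Isomorphism Π (Projective.PG 𝔽 vectorSpace) ]
        (∀ S → proj₁ S ≐ line (proj₁ (Isomorphism.to θ S))))

    Induces : Collineation PG → Collineation Π → Set (suc ℓ)
    Induces κ κΠ = ∀ S → proj₁ (Isomorphism.to κΠ S) ≐ κ ⟦ proj₁ S ⟧

    IsSemilinear : Collineation Π → Set (suc ℓ)
    IsSemilinear κΠ =
      Σ[ σ ∈ (𝔽.Carrier → 𝔽.Carrier) ] Σ[ g ∈ (Carrierᴹ → Carrierᴹ) ]
        RingMorphisms.IsRingIsomorphism 𝔽.rawRing 𝔽.rawRing σ ×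
        GroupMorphisms.IsGroupIsomorphism +ᴹ-rawGroup +ᴹ-rawGroup g ×
        (∀ a v → g (a · v) ≈ᴹ σ a · g v) ×
        (∀ S → proj₁ (Isomorphism.to κΠ S) ≐
               pointsOf (λ w → Σ[ v ∈ Point ] v ∈ proj₁ S × w ≈ᴹ g (proj₁ v)))

    FixedPointsAre : Collineation Π → Pred PointSet ℓ → Set (suc ℓ)
    FixedPointsAre κΠ ℛ =
      ∀ S → proj₁ (Isomorphism.to κΠ S) ≐ proj₁ S ⇔ proj₁ S ∈ ℛ

    -- ℛ consists of the ⟨ u ⟩ with 0 ≠ u ∈ U, for an n-dimensional
    -- 𝕂-subspace U (with basis b) spanning V over 𝔽
    IsSubgeometry : Pred PointSet ℓ → Set (suc ℓ)
    IsSubgeometry ℛ =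
      Σ[ b ∈ Vector Carrierᴹ n ]
        LinearlyIndependent b ×
        (∀ v → Projective.InSpan 𝔽 vectorSpace b v) ×
        (∀ S → S ∈ ℛ ⇔ (Σ[ u ∈ Point ] u ∈ pointsOf (InSpan b) × S ≐ line (proj₁ u)))

    InducesSemilinearFixing : Pred PointSet ℓ → Collineation PG → Set (suc ℓ)
    InducesSemilinearFixing ℛ Ξ =
      IsLinear Ξ × MapsFamily Ξ members members ×
      (Σ[ ξ ∈ Collineation Π ]
        Induces Ξ ξ × IsSemilinear ξ × HasOrder ξ n × FixedPointsAre ξ ℛ)

module Endomorphisms {ℓ : Level} {q n : ℕ} (ext : FiniteFieldExtension ℓ q n) where

  open FiniteFieldExtension ext
  open 𝔽
  open Exp semiring renaming (_^_ to _^ᶠ_) using ()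
  open Sum +-commutativeMonoid using (sum)
  open RingProperties (fieldRing 𝔽) using (-‿distribʳ-*; -0#≈0#; -‿+-comm)
  open SetoidReasoning setoid
  open CommutativeSemigroupProperties +-commutativeSemigroup using (interchange)

  infixr 7 _⋆_
  _⋆_ : 𝕂.Carrier → Carrier → Carrier
  k ⋆ x = ι k * x

  𝔽-over-𝕂 : VectorSpace 𝕂
  𝔽-over-𝕂 = record
    { Carrierᴹ = Carrier
    ; _≈ᴹ_ = _≈_
    ; _+ᴹ_ = _+_
    ; _*ₗ_ = _⋆_
    ; 0ᴹ = 0#
    ; -ᴹ_ = -_
    ; isLeftModule = record
      { isLeftSemimodule = record
        { +ᴹ-isCommutativeMonoid = +-isCommutativeMonoid
        ; isPreleftSemimodule = record
          { *ₗ-cong      = λ p → *-cong (ι.⟦⟧-cong p)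
          ; *ₗ-zeroˡ     = λ x → trans (*-congʳ ι.0#-homo) (zeroˡ x)
          ; *ₗ-distribʳ  = λ x k l → trans (*-congʳ (ι.+-homo k l)) (distribʳ x _ _)
          ; *ₗ-identityˡ = λ x → trans (*-congʳ ι.1#-homo) (*-identityˡ x)
          ; *ₗ-assoc     = λ k l x → trans (*-congʳ (ι.*-homo k l)) (*-assoc _ _ x)
          ; *ₗ-zeroʳ     = λ k → zeroʳ (ι k)
          ; *ₗ-distribˡ  = λ k → distribˡ (ι k)
          }
        }
      ; -ᴹ‿cong = -‿cong
      ; -ᴹ‿inverse = -‿inverse
      }
    }

  open LeftModuleMorphisms (LeftModule.rawLeftModule 𝔽-over-𝕂)
                           (LeftModule.rawLeftModule 𝔽-over-𝕂)

  End : Set ℓ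
  End = Σ[ f ∈ (Carrier → Carrier) ] IsLeftModuleHomomorphism f

  private
    isHom : {f : Carrier → Carrier} →
            (∀ {x y} → x ≈ y → f x ≈ f y) →
            (∀ x y → f (x + y) ≈ f x + f y) →
            f 0# ≈ 0# →
            (∀ x → f (- x) ≈ - f x) →
            (∀ k x → f (k ⋆ x) ≈ k ⋆ f x) →
            IsLeftModuleHomomorphism f
    isHom cong add zero neg scale = record
      { +ᴹ-isGroupHomomorphism = record
        { isMonoidHomomorphism = record
          { isMagmaHomomorphism = record
            { isRelHomomorphism = record { cong = cong } ; homo = add }
          ; ε-homo = zero
          }
        ; ⁻¹-homo = neg
        }
      ; *ₗ-homo = scale
      }

    module Hom = IsLeftModuleHomomorphism

  _+ᴱ_ : End → End → End
  (f , F) +ᴱ (g , G) = (λ x → f x + g x) , isHom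
    (λ p → +-cong (Hom.⟦⟧-cong F p) (Hom.⟦⟧-cong G p))
    (λ x y → trans (+-cong (Hom.+ᴹ-homo F x y) (Hom.+ᴹ-homo G x y)) (interchange _ _ _ _))
    (trans (+-cong (Hom.0ᴹ-homo F) (Hom.0ᴹ-homo G)) (+-identityˡ 0#))
    (λ x → trans (+-cong (Hom.-ᴹ-homo F x) (Hom.-ᴹ-homo G x)) (-‿+-comm _ _))
    (λ k x → trans (+-cong (Hom.*ₗ-homo F k x) (Hom.*ₗ-homo G k x)) (sym (distribˡ _ _ _)))

  0ᴱ : End
  0ᴱ = (λ _ → 0#) , isHom
    (λ _ → refl)
    (λ _ _ → sym (+-identityˡ 0#))
    refl
    (λ _ → sym -0#≈0#)
    (λ k _ → sym (zeroʳ (ι k)))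

  -ᴱ_ : End → End
  -ᴱ (f , F) = (λ x → - f x) , isHom
    (λ p → -‿cong (Hom.⟦⟧-cong F p))
    (λ x y → trans (-‿cong (Hom.+ᴹ-homo F x y)) (sym (-‿+-comm _ _)))
    (trans (-‿cong (Hom.0ᴹ-homo F)) -0#≈0#)
    (λ x → -‿cong (Hom.-ᴹ-homo F x))
    (λ k x → trans (-‿cong (Hom.*ₗ-homo F k x)) (-‿distribʳ-* _ _))

  _*ᴱ_ : 𝕂.Carrier → End → End
  k *ᴱ (f , F) = (λ x → k ⋆ f x) , isHom
    (λ p → *-congˡ (Hom.⟦⟧-cong F p))
    (λ x y → trans (*-congˡ (Hom.+ᴹ-homo F x y)) (distribˡ _ _ _))
    (trans (*-congˡ (Hom.0ᴹ-homo F)) (zeroʳ _))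
    (λ x → trans (*-congˡ (Hom.-ᴹ-homo F x)) (sym (-‿distribʳ-* _ _)))
    (λ l x → begin
      k ⋆ f (l ⋆ x)       ≈⟨ *-congˡ (Hom.*ₗ-homo F l x) ⟩
      k ⋆ (l ⋆ f x)       ≈⟨ *-assoc _ _ _ ⟨
      (ι k * ι l) * f x   ≈⟨ *-congʳ (HeytingField.*-comm 𝔽 _ _) ⟩
      (ι l * ι k) * f x   ≈⟨ *-assoc _ _ _ ⟩
      l ⋆ (k ⋆ f x)       ∎)

  𝔼 : VectorSpace 𝕂
  𝔼 = record
    { Carrierᴹ = End
    ; _≈ᴹ_ = λ φ ψ → ∀ x → proj₁ φ x ≈ proj₁ ψ x
    ; _+ᴹ_ = _+ᴱ_
    ; _*ₗ_ = _*ᴱ_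
    ; 0ᴹ = 0ᴱ
    ; -ᴹ_ = -ᴱ_
    ; isLeftModule = record
      { isLeftSemimodule = record
        { +ᴹ-isCommutativeMonoid = record
          { isMonoid = record
            { isSemigroup = record
              { isMagma = record
                { isEquivalence = record
                  { refl  = λ _ → refl
                  ; sym   = λ p x → sym (p x)
                  ; trans = λ p r x → trans (p x) (r x)
                  }
                ; ∙-cong = λ p r x → +-cong (p x) (r x)
                }
              ; assoc = λ _ _ _ _ → +-assoc _ _ _
              }
            ; identity = (λ _ _ → +-identityˡ _) , (λ _ _ → +-identityʳ _)
            }
          ; comm = λ _ _ _ → +-comm _ _
          }
        ; isPreleftSemimodule = record
          { *ₗ-cong      = λ p r x → *-cong (ι.⟦⟧-cong p) (r x)
          ; *ₗ-zeroˡ     = λ _ _ → 𝔽ₖ.*ₗ-zeroˡ _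
          ; *ₗ-distribʳ  = λ _ _ _ _ → 𝔽ₖ.*ₗ-distribʳ _ _ _
          ; *ₗ-identityˡ = λ _ _ → 𝔽ₖ.*ₗ-identityˡ _
          ; *ₗ-assoc     = λ _ _ _ _ → 𝔽ₖ.*ₗ-assoc _ _ _
          ; *ₗ-zeroʳ     = λ k _ → 𝔽ₖ.*ₗ-zeroʳ k
          ; *ₗ-distribˡ  = λ _ _ _ _ → 𝔽ₖ.*ₗ-distribˡ _ _ _
          }
        }
      ; -ᴹ‿cong = λ p x → -‿cong (p x)
      ; -ᴹ‿inverse = (λ _ _ → -‿inverseˡ _) , (λ _ _ → -‿inverseʳ _)
      }
    }
    where module 𝔽ₖ = LeftModule 𝔽-over-𝕂

  open Projective 𝕂 𝔼 public
  open Desarguesian ext 𝔼 public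
  open DesarguesianSpread public using (members)

  t : Carrier → Carrier → Carrier
  t a x = a * x

  -- the trace onto F_q, regarded as a map into F_{q^n} ⊇ F_q
  Tr : Carrier → Carrier
  Tr x = sum {n} (λ i → x ^ᶠ (q ^ toℕ i))

  -- p = ⟨ f ⟩; the function f is not assumed linear, but no p satisfies
  -- this unless it is
  _Is⟨_⟩ : Point → (Carrier → Carrier) → Set ℓ
  p Is⟨ f ⟩ = Σ[ r ∈ Point ] (∀ x → proj₁ (proj₁ r) x ≈ f x) × p ∼ r

  NonZero : Carrier → Set ℓ
  NonZero a = ¬ a ≈ 0#

  ℛ₁ ℛ₂ : Pred PointSet ℓ
  ℛ₁ S = ∃[ μ ] NonZero μ × S ≐ (λ p → ∃[ α ] NonZero α × p Is⟨ t α ∘ Tr ∘ t μ ⟩)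
  ℛ₂ S = ∃[ μ ] NonZero μ × S ≐ (λ p → ∃[ α ] NonZero α × p Is⟨ t μ ∘ Tr ∘ t α ⟩)

  ℐ : PointSet
  ℐ p = ∃[ μ ] NonZero μ × p Is⟨ t μ ⟩

  -- membership in H(𝒮ₙₙ)
  IsInH : Collineation PG → Set (suc ℓ)
  IsInH κ = IsLinear κ × MapsFamily κ ℛ₁ ℛ₁ × MapsFamily κ ℛ₂ ℛ₂

  Is𝒟-Subspace : PointSet → Set (suc ℓ)
  Is𝒟-Subspace X = Σ[ κ ∈ Collineation PG ] IsInH κ × X ≐ κ ⟦ ℐ ⟧

{-# OPTIONS --safe #-}
module Submission where

-- Composition with the maps t a on the left makes 𝔼 an 𝔽-vector space, in which the functionals
-- Tr ∘ t μ form the 𝕂-span of an 𝔽-basis, so that ℛ₁ is a subgeometry of the resulting Desarguesian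
-- spread 𝒟.  Raising the coordinates in that basis to the q-th power is 𝕂-linear on 𝔼, semilinear over
-- 𝔽, and fixes precisely the members of ℛ₁; moreover ℐ is the line of the identity.  Taking adjoints
-- with respect to the trace form (x , y) ↦ Tr (x y) is a 𝕂-linear involution A of 𝔼 that fixes every
-- t a and interchanges t α ∘ Tr ∘ t μ with t μ ∘ Tr ∘ t α, hence ℛ₁ with ℛ₂.  If X = f ℐ with f in
-- the group of the Segre variety, then 𝒟₁ = f 𝒟, 𝒟₂ = f (A 𝒟), and Φ = f A f⁻¹ carries 𝒟₁ to 𝒟₂.

open import Defs
open import Algebra.Apartness.Bundles using (HeytingCommutativeRing; HeytingField)
open import Algebra.Bundles using (CommutativeRing; CommutativeSemiring)
open import Algebra.Module.Bundles using (LeftModule)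
open import Algebra.Module.Morphism.Structures using (module LeftModuleMorphisms)
import Algebra.Module.Properties.LeftModule as ModuleProperties
open import Algebra.Module.Structures using (IsLeftModule)
import Algebra.Properties.CommutativeMonoid.Sum as Sum
import Algebra.Properties.CommutativeSemiring.Binomial as Binomial
import Algebra.Properties.CommutativeSemiring.Exp as CommutativeExp
import Algebra.Properties.Group as GroupProperties
import Algebra.Properties.Ring as RingProperties
import Algebra.Properties.Semiring.Mult as Mult
import Algebra.Properties.Semiring.Sum as SemiringSum
import Algebra.Solver.Ring.NaturalCoefficients.Default as SemiringSolver
open import Data.Fin using
  (Fin; zero; suc; toℕ; fromℕ; fromℕ<; inject₁; inject≤; punchOut; finToFun; funToFin; combine)
open import Data.Fin.Permutation using (Permutation; permutation; _⟨$⟩ʳ_)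
open import Data.Fin.Properties as Fin using (any?; toℕ-inject₁; toℕ-fromℕ; punchInᵢ≢i)
open import Data.Nat as ℕ using (ℕ; zero; suc; _≤_; _<_; s≤s; z≤n)
open import Data.Nat.Combinatorics using (_C_; nCn≡1)
open import Data.Nat.GeneralisedArithmetic using (iterate)
import Data.Nat.Properties as ℕ
open import Data.Product using (Σ-syntax; ∃; ∃-syntax; _×_; _,_; proj₁; proj₂)
open import Data.Vec.Functional using (Vector; removeAt)
open import Function using (_∘_; _⇔_; mk⇔; Equivalence; Inverse)
open import Level using (Level)
open import Relation.Binary using (Setoid)
open import Relation.Binary.PropositionalEquality as ≡ using (_≡_; _≢_)
import Relation.Binary.Reasoning.Setoid as SetoidReasoning
open import Relation.Nullary using (¬_; Dec; yes; no; contradiction)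
open import Relation.Nullary.Decidable using (map′; ¬?; decidable-stable)
open import Relation.Unary using (Pred; _∈_; _⊆_; _≐_; ⋃)
open import Relation.Unary.Properties using (≐-refl; ≐-sym; ≐-trans)

-- The number `q` is known only as the size of `𝕂`, so the facts about Frobenius all come from
-- counting roots. A nonzero polynomial with `d` coefficients has fewer than `d` distinct roots;
-- applied to fields of known size, this gives the additivity of `x ↦ x^q`, the fixed field `ι 𝕂`
-- and a nonzero trace. Dimension arguments likewise become comparisons of `q^m` with `q^n`. The
-- functionals `Tr (d i * x)`, with `d` trace-dual to a `𝕂`-basis `e` of `𝔽`, are chosen because the
-- coordinates of `φ` in them are the values `φ (e i)`. Hence the maps `Tr ∘ t μ` are exactly those
-- with all coordinates in `𝕂`. Both spreads come from one construction. For any `𝕂`-automorphism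
-- `g`, the structure `a · v = g (a ∘ g⁻¹ v)` has the desired properties as soon as the family in
-- question consists of the `g`-images of the standard lines through the `Tr ∘ t μ`. For `ℛ₁` and
-- `g = f` this holds because `f` permutes `ℛ₁`; for `ℛ₂` one takes `g = f A`, since `A` turns left
-- families into right ones. A linear collineation determines its linear map only up to a scalar at
-- each point; such scalars are absorbed into the parameters of the families.

-- Additivity of power maps in a commutative semiring.

module Frobenius {ℓ : Level} (S : CommutativeSemiring ℓ ℓ) where

  open CommutativeSemiring S hiding (zero)
  open CommutativeExp S using (_^_)
  open Mult semiring renaming (_×_ to _×ˢ_) using (×-assoc-*; ×-congʳ)
  open SemiringSum semiring using (sum; sum-cong-≋; sum-init-last; sum-replicate-zero)
  open SetoidReasoning setoid

  1^ : ∀ k → 1# ^ k ≈ 1#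
  1^ zero    = refl
  1^ (suc k) = trans (*-identityˡ _) (1^ k)

  ^-zeroˡ : ∀ k → 0 < k → 0# ^ k ≈ 0#
  ^-zeroˡ (suc k) _ = zeroˡ _

  -- The hypothesis holds if the ring has prime characteristic p and m is a power of p.
  ^-distrib-+ : ∀ {m} → 0 < m → (∀ k → 0 < k → k < m → (m C k) ×ˢ 1# ≈ 0#) →
                ∀ x y → (x + y) ^ m ≈ x ^ m + y ^ m
  ^-distrib-+ {suc m} _ vanish x y = begin
    (x + y) ^ suc m                    ≈⟨ Binomial.theorem S (suc m) x y ⟩
    term zero + sum (term ∘ suc)       ≈⟨ +-cong first (sum-init-last (term ∘ suc)) ⟩
    y ^ suc m + (sum (term ∘ suc ∘ inject₁) + term (suc (fromℕ m)))
      ≈⟨ +-congˡ (+-cong (trans (sum-cong-≋ middle) (sum-replicate-zero m)) last) ⟩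
    y ^ suc m + (0# + x ^ suc m)       ≈⟨ +-congˡ (+-identityˡ _) ⟩
    y ^ suc m + x ^ suc m              ≈⟨ +-comm _ _ ⟩
    x ^ suc m + y ^ suc m              ∎
    where
    term : Fin (suc (suc m)) → Carrier
    term = Binomial.binomialTerm S x y (suc m)

    first : term zero ≈ y ^ suc m
    first = trans (+-identityʳ _) (*-identityˡ _)

    last : term (suc (fromℕ m)) ≈ x ^ suc m
    last rewrite toℕ-fromℕ m | nCn≡1 (suc m) | ℕ.n∸n≡0 m =
      trans (+-identityʳ _) (*-identityʳ _)

    middle : ∀ i → term (suc (inject₁ i)) ≈ 0#
    middle i = begin
      c ×ˢ z             ≈⟨ ×-congʳ c (*-identityˡ z) ⟨
      c ×ˢ (1# * z)      ≈⟨ ×-assoc-* c 1# z ⟨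
      (c ×ˢ 1#) * z      ≈⟨ *-congʳ (vanish (suc (toℕ (inject₁ i))) (s≤s z≤n) bound) ⟩
      0# * z             ≈⟨ zeroˡ z ⟩
      0#                 ∎
      where
      c = suc m C suc (toℕ (inject₁ i))
      z = Binomial.binomial S x y (suc m) (suc (inject₁ i))
      bound : suc (toℕ (inject₁ i)) < suc m
      bound rewrite toℕ-inject₁ i = s≤s (Fin.toℕ<n i)

-- Finite fields: search, Fermat's theorem, root counting and vanishing binomial coefficients.

commutativeRing : {ℓ : Level} → HeytingField ℓ ℓ ℓ → CommutativeRing ℓ ℓ
commutativeRing L = HeytingCommutativeRing.commutativeRing (HeytingField.heytingCommutativeRing L)

module FiniteField {ℓ : Level} (L : HeytingField ℓ ℓ ℓ) {m : ℕ}
                   (size : HasSize (CommutativeRing.setoid (commutativeRing L)) m) where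

  open CommutativeRing (commutativeRing L) hiding (zero)
  open CommutativeExp commutativeSemiring using (_^_; ^-congˡ; ^-congʳ)
  open Mult semiring renaming (_×_ to _×ˢ_) using (×-assoc-*; ×-congʳ)
  open SemiringSum semiring using (sum; sum-cong-≋; sum-init-last; *-distribˡ-sum)
  open RingProperties ring using (-‿distribʳ-*; -0#≈0#; -‿+-comm)
  open GroupProperties +-group using (x∙y⁻¹≈ε⇒x≈y; x≈y⇒x∙y⁻¹≈ε; //-rightDividesˡ)
    renaming (∙-cancelʳ to +-cancelʳ)
  open SetoidReasoning setoid
  private module Size = Inverse size

  index : Carrier → Fin m
  index = Size.to

  element : Fin m → Carrier
  element = Size.from

  element∘index : ∀ x → element (index x) ≈ x
  element∘index = Size.strictlyInverseʳ

  index∘element : ∀ i → index (element i) ≡ i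
  index∘element = Size.strictlyInverseˡ

  index-injective : ∀ {x y} → index x ≡ index y → x ≈ y
  index-injective {x} {y} p =
    trans (sym (element∘index x)) (trans (Size.from-cong p) (element∘index y))

  element-injective : ∀ {i j} → element i ≈ element j → i ≡ j
  element-injective {i} {j} p =
    ≡.trans (≡.sym (index∘element i)) (≡.trans (Size.to-cong p) (index∘element j))

  infix 4 _≟_
  _≟_ : ∀ x y → Dec (x ≈ y)
  x ≟ y = map′ index-injective Size.to-cong (index x Fin.≟ index y)

  -- Finiteness makes existence decidable. This is how witnesses are obtained below: the alternative
  -- outcome refutes every candidate, and a counting argument excludes it.
  search : {P : Carrier → Set ℓ} → (∀ {x y} → x ≈ y → P x → P y) → (∀ x → Dec (P x)) → Dec (∃ P)
  search resp P? = map′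
    (λ (i , p) → element i , p)
    (λ (x , p) → index x , resp (sym (element∘index x)) p)
    (any? (P? ∘ element))

  private
    module L = HeytingField L

  -- If 0 were 1, then `0 - 0` would be invertible, which would make 0 apart from itself.
  0≉1 : ¬ 0# ≈ 1#
  0≉1 0≈1 = L.#-irrefl refl (L.invertible⇒# {0#} {0#}
    (0# , trans (zeroˡ _) 0≈1 , trans (zeroʳ _) 0≈1))

  -- The hypothesis is inequality, whereas the field axioms give inverses only from apartness.
  -- Search decides whether an inverse exists; if none does, `x` is not apart from 0, and tightness
  -- gives `x ≈ 0#`.
  inverse : ∀ {x} → ¬ x ≈ 0# → ∃[ y ] y * x ≈ 1#
  inverse {x} x≉0 with search (λ p → trans (*-congʳ (sym p))) (λ y → y * x ≟ 1#)
  ... | yes found = found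
  ... | no none = contradiction (proj₁ (L.tight x 0#) not-apart) x≉0
    where
    not-apart : ¬ x L.# 0#
    not-apart x#0 with y , p , _ ← L.#⇒invertible x#0 =
      none (y , trans (*-congˡ (sym (trans (+-congˡ -0#≈0#) (+-identityʳ x)))) p)

  *-cancelˡ-nonzero : ∀ {x y z} → ¬ x ≈ 0# → x * y ≈ x * z → y ≈ z
  *-cancelˡ-nonzero {x} {y} {z} x≉0 p with x⁻¹ , q ← inverse x≉0 = begin
    y              ≈⟨ *-identityˡ y ⟨
    1# * y         ≈⟨ *-congʳ q ⟨
    x⁻¹ * x * y    ≈⟨ *-assoc _ _ _ ⟩
    x⁻¹ * (x * y)  ≈⟨ *-congˡ p ⟩
    x⁻¹ * (x * z)  ≈⟨ *-assoc _ _ _ ⟨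
    x⁻¹ * x * z    ≈⟨ *-congʳ q ⟩
    1# * z         ≈⟨ *-identityˡ z ⟩
    z              ∎

  x*y≈0⇒y≈0 : ∀ {x y} → ¬ x ≈ 0# → x * y ≈ 0# → y ≈ 0#
  x*y≈0⇒y≈0 x≉0 p = *-cancelˡ-nonzero x≉0 (trans p (sym (zeroʳ _)))

  *-nonzero : ∀ {x y} → ¬ x ≈ 0# → ¬ y ≈ 0# → ¬ x * y ≈ 0#
  *-nonzero x≉0 y≉0 = y≉0 ∘ x*y≈0⇒y≈0 x≉0

  private
    module Π = Sum *-commutativeMonoid

    -- Replacing the factor at 0 by 1 lets a product over the whole field stand for a product over
    -- its nonzero elements.
    factor : Carrier → Carrier → Carrier
    factor x y with y ≟ 0#
    ... | yes _ = 1#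
    ... | no _  = x

    factor-≈0 : ∀ {x y} → y ≈ 0# → factor x y ≈ 1#
    factor-≈0 {x} {y} p with y ≟ 0#
    ... | yes _ = refl
    ... | no ¬p = contradiction p ¬p

    factor-≉0 : ∀ {x y} → ¬ y ≈ 0# → factor x y ≈ x
    factor-≉0 {x} {y} ¬p with y ≟ 0#
    ... | yes p = contradiction p ¬p
    ... | no _  = refl

    factor-nonzero : ∀ y → ¬ factor y y ≈ 0#
    factor-nonzero y with y ≟ 0#
    ... | yes _ = 0≉1 ∘ sym
    ... | no ¬p = ¬p

    factor-* : ∀ {x y z} → ¬ x ≈ 0# → z ≈ x * y → factor z z ≈ factor x y * factor y y
    factor-* {x} {y} {z} x≉0 p with y ≟ 0#
    ... | yes q = trans (factor-≈0 (trans p (trans (*-congˡ q) (zeroʳ x)))) (sym (*-identityˡ 1#))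
    ... | no ¬q = trans (factor-≉0 (*-nonzero x≉0 ¬q ∘ trans (sym p))) p

    product-nonzero : ∀ {k} (f : Vector Carrier k) → (∀ i → ¬ f i ≈ 0#) → ¬ Π.sum f ≈ 0#
    product-nonzero {zero}  f f≉0 p = 0≉1 (sym p)
    product-nonzero {suc k} f f≉0 = *-nonzero (f≉0 zero) (product-nonzero (f ∘ suc) (f≉0 ∘ suc))

    product-const : ∀ {k x} (f : Vector Carrier k) → (∀ i → f i ≈ x) → Π.sum f ≈ x ^ k
    product-const {zero}  f p = refl
    product-const {suc k} f p = *-cong (p zero) (product-const (f ∘ suc) (p ∘ suc))

    -- The additional `x` makes up for the index where the factor is 1, so the exponent is `k` and
    -- not `k - 1`.
    product-const-but-one : ∀ {k x} (f : Vector Carrier k) i → f i ≈ 1# →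
                            (∀ j → j ≢ i → f j ≈ x) → x * Π.sum f ≈ x ^ k
    product-const-but-one {suc k} {x} f i p q = *-congˡ (begin
      Π.sum f                     ≈⟨ Π.sum-remove {i = i} f ⟩
      f i * Π.sum (removeAt f i)  ≈⟨ *-cong p (product-const _ λ j → q _ (punchInᵢ≢i i j)) ⟩
      1# * x ^ k                  ≈⟨ *-identityˡ _ ⟩
      x ^ k                       ∎)

  -- Multiplication by x permutes the nonzero elements, so their product P satisfies P = xᵐ⁻¹ P.
  fermat : ∀ x → x ^ m ≈ x
  fermat x with x ≟ 0#
  ... | yes x≈0 = trans (^-congˡ m x≈0) (trans (0^ (index 0#)) (sym x≈0))
    where
    0^ : ∀ {k} → Fin k → 0# ^ k ≈ 0#
    0^ {suc k} _ = zeroˡ _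
  ... | no x≉0 with x⁻¹ , q ← inverse x≉0 = begin
    x ^ m       ≈⟨ product-const-but-one F (index 0#) (factor-≈0 (element∘index 0#))
                    (λ j j≢0 → factor-≉0 λ p → j≢0 (element-injective (trans p (sym (element∘index 0#))))) ⟨
    x * Π.sum F ≈⟨ *-congˡ ΠF≈1 ⟩
    x * 1#      ≈⟨ *-identityʳ x ⟩
    x           ∎
    where
    F P : Vector Carrier m
    F i = factor x (element i)
    P i = factor (element i) (element i)

    π : Permutation m m
    π = permutation (λ i → index (x * element i)) (λ i → index (x⁻¹ * element i))
      (λ i → cancel (trans (*-comm x x⁻¹) q) i)
      (λ i → cancel q i)
      where
      cancel : ∀ {a b} → a * b ≈ 1# → ∀ i → index (a * element (index (b * element i))) ≡ i
      cancel {a} {b} p i = ≡.trans (Size.to-cong (begin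
        a * element (index (b * element i))  ≈⟨ *-congˡ (element∘index _) ⟩
        a * (b * element i)                  ≈⟨ *-assoc _ _ _ ⟨
        a * b * element i                    ≈⟨ *-congʳ p ⟩
        1# * element i                       ≈⟨ *-identityˡ _ ⟩
        element i                            ∎)) (index∘element i)

    ΠF≈1 : Π.sum F ≈ 1#
    ΠF≈1 = *-cancelˡ-nonzero (product-nonzero P (factor-nonzero ∘ element)) (begin
      Π.sum P * Π.sum F                ≈⟨ *-comm _ _ ⟩
      Π.sum F * Π.sum P                ≈⟨ Π.∑-distrib-+ F P ⟨
      Π.sum (λ i → F i * P i)          ≈⟨ Π.sum-cong-≋ {m} (λ i → factor-* x≉0 (element∘index (x * element i))) ⟨
      Π.sum (λ i → P (π ⟨$⟩ʳ i))       ≈⟨ Π.∑-permute P π ⟨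
      Π.sum P                          ≈⟨ *-identityʳ _ ⟨
      Π.sum P * 1#                     ∎)

  -- Horner evaluation with the constant coefficient in front: a vector of length `d` is a
  -- polynomial of degree less than `d`.
  eval : ∀ {d} → Vector Carrier d → Carrier → Carrier
  eval {zero}  a x = 0#
  eval {suc d} a x = a zero + x * eval (a ∘ suc) x

  eval-zero : ∀ {d} {a : Vector Carrier d} → (∀ i → a i ≈ 0#) → ∀ x → eval a x ≈ 0#
  eval-zero {zero}  p x = refl
  eval-zero {suc d} p x = trans (+-cong (p zero) (trans (*-congˡ (eval-zero (p ∘ suc) x)) (zeroʳ x))) (+-identityˡ 0#)

  eval-cong : ∀ {d} (a : Vector Carrier d) {x y} → x ≈ y → eval a x ≈ eval a y
  eval-cong {zero}  a p = refl
  eval-cong {suc d} a p = +-congˡ (*-cong p (eval-cong (a ∘ suc) p))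

  eval-+ : ∀ {d} (a b : Vector Carrier d) x → eval (λ i → a i + b i) x ≈ eval a x + eval b x
  eval-+ {zero}  a b x = sym (+-identityˡ 0#)
  eval-+ {suc d} a b x = trans (+-congˡ (*-congˡ (eval-+ (a ∘ suc) (b ∘ suc) x)))
    (solve 5 (λ a b x p q → (a :+ b) :+ x :* (p :+ q) := (a :+ x :* p) :+ (b :+ x :* q)) refl _ _ _ _ _)
    where open SemiringSolver commutativeSemiring

  eval-neg : ∀ {d} (a : Vector Carrier d) x → eval (λ i → - a i) x ≈ - eval a x
  eval-neg {zero}  a x = sym (-0#≈0#)
  eval-neg {suc d} a x = begin
    - a zero + x * eval (λ i → - a (suc i)) x  ≈⟨ +-congˡ (*-congˡ (eval-neg (a ∘ suc) x)) ⟩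
    - a zero + x * - eval (a ∘ suc) x          ≈⟨ +-congˡ (-‿distribʳ-* _ _) ⟨
    - a zero + - (x * eval (a ∘ suc) x)        ≈⟨ -‿+-comm _ _ ⟩
    - (a zero + x * eval (a ∘ suc) x)          ∎

  -- Synthetic division by `X - r`: the coefficients of the quotient are the partial values of
  -- Horner's scheme at `r`.
  quotient : ∀ {d} → Vector Carrier (suc d) → Carrier → Vector Carrier d
  quotient {suc d} a r zero    = eval (a ∘ suc) r
  quotient {suc d} a r (suc i) = quotient (a ∘ suc) r i

  -- Evaluating at `r + h` rather than at `x` avoids subtraction, so each step is a semiring
  -- identity.
  eval-quotient : ∀ {d} (a : Vector Carrier (suc d)) r h →
                  eval a (r + h) ≈ eval a r + h * eval (quotient a r) (r + h)
  eval-quotient {zero} a r h = solve 3 (λ a r h →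
    a :+ (r :+ h) :* con 0 := (a :+ r :* con 0) :+ h :* con 0) refl _ _ _
    where open SemiringSolver commutativeSemiring
  eval-quotient {suc d} a r h = trans (+-congˡ (*-congˡ (eval-quotient (a ∘ suc) r h)))
    (solve 5 (λ a r h A Q →
      a :+ (r :+ h) :* (A :+ h :* Q) := (a :+ r :* A) :+ h :* (A :+ (r :+ h) :* Q)) refl _ _ _ _ _)
    where open SemiringSolver commutativeSemiring

  -- The quotient depends on the nonconstant coefficients of `a` through a unitriangular system,
  -- which is solved from the top coefficient downwards.
  quotient-zero : ∀ {d} (a : Vector Carrier (suc d)) r → (∀ i → quotient a r i ≈ 0#) →
                  ∀ i → a (suc i) ≈ 0#
  quotient-zero {suc d} a r p = λ where
      zero    → trans (sym (trans (+-congˡ (trans (*-congˡ (eval-zero rest r)) (zeroʳ r))) (+-identityʳ _))) (p zero)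
      (suc i) → rest i
    where
    rest : ∀ i → a (suc (suc i)) ≈ 0#
    rest = quotient-zero (a ∘ suc) r (p ∘ suc)

  -- After division by `X - r₀` the other roots remain, because `rᵢ - r₀` is nonzero and cancels.
  -- Induction kills the quotient, hence all coefficients but the constant one, which is then the
  -- value at `r₀`.
  roots⇒zero : ∀ {d} (a : Vector Carrier d) (r : Vector Carrier d) →
               (∀ {i j} → r i ≈ r j → i ≡ j) → (∀ i → eval a (r i) ≈ 0#) → ∀ i → a i ≈ 0#
  roots⇒zero {zero}  a r inj root = λ ()
  roots⇒zero {suc d} a r inj root = λ where
      zero    → trans (sym (trans (+-congˡ (trans (*-congˡ (eval-zero tail≈0 _)) (zeroʳ _))) (+-identityʳ _)))
                      (root zero)
      (suc i) → tail≈0 i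
    where
    quotient-root : ∀ i → eval (quotient a (r zero)) (r (suc i)) ≈ 0#
    quotient-root i = x*y≈0⇒y≈0 {h} h≉0 (begin
      h * eval Q (r (suc i))                    ≈⟨ *-congˡ (eval-cong Q x≈) ⟩
      h * eval Q (r zero + h)                   ≈⟨ +-identityˡ _ ⟨
      0# + h * eval Q (r zero + h)              ≈⟨ +-congʳ (root zero) ⟨
      eval a (r zero) + h * eval Q (r zero + h) ≈⟨ eval-quotient a (r zero) h ⟨
      eval a (r zero + h)                       ≈⟨ eval-cong a x≈ ⟨
      eval a (r (suc i))                        ≈⟨ root (suc i) ⟩
      0#                                        ∎)
      where
      Q = quotient a (r zero)
      h = r (suc i) - r zero
      h≉0 : ¬ h ≈ 0#
      h≉0 p with () ← inj (x∙y⁻¹≈ε⇒x≈y _ _ p)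
      x≈ : r (suc i) ≈ r zero + h
      x≈ = trans (sym (//-rightDividesˡ (r zero) (r (suc i)))) (+-comm _ _)

    tail≈0 : ∀ i → a (suc i) ≈ 0#
    tail≈0 = quotient-zero a (r zero) (roots⇒zero _ (r ∘ suc) (Fin.suc-injective ∘ inj) quotient-root)

  eval-sum : ∀ {d} (a : Vector Carrier d) x → eval a x ≈ sum (λ i → a i * x ^ toℕ i)
  eval-sum {zero}  a x = refl
  eval-sum {suc d} a x = +-cong (sym (*-identityʳ _)) (begin
    x * eval (a ∘ suc) x                      ≈⟨ *-congˡ (eval-sum (a ∘ suc) x) ⟩
    x * sum (λ i → a (suc i) * x ^ toℕ i)     ≈⟨ *-distribˡ-sum {d} x _ ⟩
    sum (λ i → x * (a (suc i) * x ^ toℕ i))   ≈⟨ sum-cong-≋ {d} (λ i → swap _ _ _) ⟩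
    sum (λ i → a (suc i) * (x * x ^ toℕ i))   ∎)
    where
    swap : ∀ x y z → x * (y * z) ≈ y * (x * z)
    swap x y z = trans (sym (*-assoc x y z)) (trans (*-congʳ (*-comm x y)) (*-assoc y x z))

  IsPolynomial : ℕ → (Carrier → Carrier) → Set ℓ
  IsPolynomial d f = Σ[ a ∈ Vector Carrier d ] (∀ x → f x ≈ eval a x)

  zero-isPolynomial : ∀ {d} → IsPolynomial d (λ _ → 0#)
  zero-isPolynomial {d} = (λ _ → 0#) , λ x → sym (eval-zero {d} (λ _ → refl) x)

  +-isPolynomial : ∀ {d f g} → IsPolynomial d f → IsPolynomial d g → IsPolynomial d (λ x → f x + g x)
  +-isPolynomial (a , p) (b , q) = (λ i → a i + b i) , λ x → trans (+-cong (p x) (q x)) (sym (eval-+ a b x))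

  neg-isPolynomial : ∀ {d f} → IsPolynomial d f → IsPolynomial d (λ x → - f x)
  neg-isPolynomial (a , p) = (λ i → - a i) , λ x → trans (-‿cong (p x)) (sym (eval-neg a x))

  ^-isPolynomial : ∀ {d k} → k < d → IsPolynomial d (_^ k)
  ^-isPolynomial {suc d} {zero}  (s≤s _) = (λ { zero → 1# ; (suc _) → 0# }) , λ x →
    sym (trans (+-congˡ (trans (*-congˡ (eval-zero {d} (λ _ → refl) x)) (zeroʳ x))) (+-identityʳ 1#))
  ^-isPolynomial {suc d} {suc k} (s≤s k<d) with a , p ← ^-isPolynomial k<d =
    (λ { zero → 0# ; (suc i) → a i }) , λ x → trans (*-congˡ (p x)) (sym (+-identityˡ _))

  sum-isPolynomial : ∀ {d k} (f : Fin k → Carrier → Carrier) → (∀ i → IsPolynomial d (f i)) →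
                     IsPolynomial d (λ x → sum (λ i → f i x))
  sum-isPolynomial {k = zero}  f p = zero-isPolynomial
  sum-isPolynomial {k = suc k} f p = +-isPolynomial (p zero) (sum-isPolynomial (f ∘ suc) (p ∘ suc))

  private
    -- The coefficients of `X^d + a`: a 1 is appended at the top.
    monic : ∀ {d} → Vector Carrier d → Vector Carrier (suc d)
    monic {zero}  a _       = 1#
    monic {suc d} a zero    = a zero
    monic {suc d} a (suc i) = monic (a ∘ suc) i

    monic-top : ∀ {d} (a : Vector Carrier d) → monic a (fromℕ d) ≈ 1#
    monic-top {zero}  a = refl
    monic-top {suc d} a = monic-top (a ∘ suc)

    eval-monic : ∀ {d} (a : Vector Carrier d) x → eval (monic a) x ≈ x ^ d + eval a x
    eval-monic {zero}  a x = +-congˡ (zeroʳ x)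
    eval-monic {suc d} a x = trans (+-congˡ (*-congˡ (eval-monic (a ∘ suc) x)))
      (solve 4 (λ a x p q → a :+ x :* (p :+ q) := x :* p :+ (a :+ x :* q)) refl _ _ _ _)
      where open SemiringSolver commutativeSemiring

  -- With `d + 1` distinct roots the leading coefficient 1 would have to vanish. The nontriviality
  -- of Frobenius, its fixed field and the nonzero trace all rest on this bound.
  monic-roots : ∀ {d g} → IsPolynomial d g → (r : Vector Carrier (suc d)) →
                (∀ {i j} → r i ≈ r j → i ≡ j) → ¬ (∀ i → r i ^ d + g (r i) ≈ 0#)
  monic-roots {d} (a , p) r inj root =
    0≉1 (trans (sym (roots⇒zero (monic a) r inj vanishes (fromℕ d))) (monic-top a))
    where
    vanishes : ∀ i → eval (monic a) (r i) ≈ 0#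
    vanishes i = trans (eval-monic a (r i)) (trans (+-congˡ (sym (p (r i)))) (root i))

  -- The difference has `m` coefficients and vanishes at all `m` elements of the field.
  coefficients-unique : ∀ {a b : Vector Carrier m} → (∀ x → eval a x ≈ eval b x) → ∀ i → a i ≈ b i
  coefficients-unique {a} {b} p i = x∙y⁻¹≈ε⇒x≈y _ _ (roots⇒zero (λ j → a j - b j) element element-injective
    (λ j → begin
      eval (λ j → a j - b j) (element j)             ≈⟨ eval-+ a _ _ ⟩
      eval a (element j) + eval (-_ ∘ b) (element j) ≈⟨ +-congˡ (eval-neg b _) ⟩
      eval a (element j) - eval b (element j)        ≈⟨ x≈y⇒x∙y⁻¹≈ε (p _) ⟩
      0#                                             ∎) i)

  -- (X + 1)ᵐ - Xᵐ - 1 has degree less than m and vanishes on the whole field.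
  binomial-vanishes : ∀ k → 0 < k → k < m → (m C k) ×ˢ 1# ≈ 0#
  binomial-vanishes = aux coefficients-unique fermat
    where
    -- The size is generalised here so that it can be matched with `suc m′`; outside it is a
    -- parameter on which the field's enumeration depends.
    aux : ∀ {m} → (∀ {a b : Vector Carrier m} → (∀ x → eval a x ≈ eval b x) → ∀ i → a i ≈ b i) →
          (∀ x → x ^ m ≈ x) → ∀ k → 0 < k → k < m → (m C k) ×ˢ 1# ≈ 0#
    aux {suc m′} unique fermat (suc k) _ (s≤s k<m′) = begin
      (suc m′ C suc k) ×ˢ 1#
        ≡⟨ ≡.cong (λ l → (suc m′ C suc l) ×ˢ 1#) (≡.sym (≡.trans (toℕ-inject₁ j) (Fin.toℕ-fromℕ< k<m′))) ⟩
      a (suc j)               ≈⟨ unique {a} {b} (λ x → trans (a-eval x) (sym (b-eval x))) (suc j) ⟩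
      0#                      ∎
      where
      j = fromℕ< k<m′
      a b : Vector Carrier (suc m′)
      a i = (suc m′ C toℕ (inject₁ i)) ×ˢ 1#
      b zero    = 1#
      b (suc _) = 0#

      b-eval : ∀ x → eval b x ≈ 1#
      b-eval x = trans (+-congˡ (trans (*-congˡ (eval-zero {m′} (λ _ → refl) x)) (zeroʳ x))) (+-identityʳ 1#)

      a-eval : ∀ x → eval a x ≈ 1#
      -- Adding `x`, which equals its own power of exponent `suc m′`, restores the leading term
      -- omitted from `a` and completes the binomial expansion of `(x + 1#) ^ suc m′`.
      a-eval x = +-cancelʳ x _ _ (begin
        eval a x + x
          ≈⟨ +-cong (eval-sum a x) (sym (fermat x)) ⟩
        sum (λ i → a i * x ^ toℕ i) + x ^ suc m′
          ≈⟨ +-cong (sum-cong-≋ {suc m′} init) last ⟩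
        sum (λ i → Binomial.binomialTerm commutativeSemiring x 1# (suc m′) (inject₁ i)) +
        Binomial.binomialTerm commutativeSemiring x 1# (suc m′) (fromℕ (suc m′))
          ≈⟨ sum-init-last (Binomial.binomialTerm commutativeSemiring x 1# (suc m′)) ⟨
        Binomial.binomialExpansion commutativeSemiring x 1# (suc m′)
          ≈⟨ Binomial.theorem commutativeSemiring (suc m′) x 1# ⟨
        (x + 1#) ^ suc m′  ≈⟨ fermat (x + 1#) ⟩
        x + 1#             ≈⟨ +-comm _ _ ⟩
        1# + x             ∎)
        where
        open Frobenius commutativeSemiring using (1^)
        init : ∀ i → a i * x ^ toℕ i ≈ Binomial.binomialTerm commutativeSemiring x 1# (suc m′) (inject₁ i)
        init i = begin
          a i * x ^ toℕ i                 ≈⟨ ×-assoc-* c 1# _ ⟩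
          c ×ˢ (1# * x ^ toℕ i)           ≈⟨ ×-congʳ c (*-identityˡ _) ⟩
          c ×ˢ (x ^ toℕ i)                ≈⟨ ×-congʳ c (^-congʳ x (≡.sym (toℕ-inject₁ i))) ⟩
          c ×ˢ (x ^ k′)                   ≈⟨ ×-congʳ c (trans (*-congˡ (1^ (suc m′ ℕ.∸ k′))) (*-identityʳ _)) ⟨
          c ×ˢ (x ^ k′ * 1# ^ (suc m′ ℕ.∸ k′)) ∎
          where
          k′ = toℕ (inject₁ i)
          c = suc m′ C k′
        last : x ^ suc m′ ≈ Binomial.binomialTerm commutativeSemiring x 1# (suc m′) (fromℕ (suc m′))
        last rewrite toℕ-fromℕ m′ | nCn≡1 (suc m′) =
          sym (trans (+-identityʳ _) (trans (*-congˡ (1^ (m′ ℕ.∸ m′))) (*-identityʳ _)))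

-- Linear algebra: spans, automorphisms and the collineations that they induce.

module VectorSpaceLemmas {ℓ : Level} (L : HeytingField ℓ ℓ ℓ) (V : VectorSpace L) where

  open Projective L V
  open LeftModule V
  open LeftModuleMorphisms rawLeftModule rawLeftModule
  open Sum +ᴹ-commutativeMonoid using (sum; sum-cong-≋; sum-replicate-zero; ∑-distrib-+)
  open SetoidReasoning ≈ᴹ-setoid
  private
    module L = CommutativeRing (commutativeRing L)

  combination-cong : ∀ {m} {a a′ : Vector L.Carrier m} {b b′ : Vector Carrierᴹ m} →
                     (∀ i → a i L.≈ a′ i) → (∀ i → b i ≈ᴹ b′ i) → combination a b ≈ᴹ combination a′ b′
  combination-cong {m} p q = sum-cong-≋ {m} (λ i → *ₗ-cong (p i) (q i))

  combination-+ : ∀ {m} (a a′ : Vector L.Carrier m) (b : Vector Carrierᴹ m) →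
                  combination (λ i → a i L.+ a′ i) b ≈ᴹ combination a b +ᴹ combination a′ b
  combination-+ {m} a a′ b =
    ≈ᴹ-trans (sum-cong-≋ {m} (λ i → *ₗ-distribʳ (b i) (a i) (a′ i))) (∑-distrib-+ {m} _ _)

  combination-zero : ∀ {m} {a : Vector L.Carrier m} (b : Vector Carrierᴹ m) →
                     (∀ i → a i L.≈ L.0#) → combination a b ≈ᴹ 0ᴹ
  combination-zero {m} b p =
    ≈ᴹ-trans (sum-cong-≋ {m} (λ i → ≈ᴹ-trans (*ₗ-congʳ (p i)) (*ₗ-zeroˡ (b i)))) (sum-replicate-zero m)

  *ₗ-distribˡ-sum : ∀ {m} c (b : Vector Carrierᴹ m) → c *ₗ sum b ≈ᴹ sum (λ i → c *ₗ b i)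
  *ₗ-distribˡ-sum {zero}  c b = *ₗ-zeroʳ c
  *ₗ-distribˡ-sum {suc m} c b =
    ≈ᴹ-trans (*ₗ-distribˡ c (b zero) _) (+ᴹ-congˡ (*ₗ-distribˡ-sum c (b ∘ suc)))

  combination-*ₗ : ∀ {m} c (a : Vector L.Carrier m) (b : Vector Carrierᴹ m) →
                   combination (λ i → c L.* a i) b ≈ᴹ c *ₗ combination a b
  combination-*ₗ {m} c a b =
    ≈ᴹ-trans (sum-cong-≋ {m} (λ i → *ₗ-assoc c (a i) (b i))) (≈ᴹ-sym (*ₗ-distribˡ-sum c (λ i → a i *ₗ b i)))

  unit : ∀ {m} → Fin m → Vector L.Carrier m
  unit zero    zero    = L.1#
  unit zero    (suc _) = L.0#
  unit (suc i) zero    = L.0#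
  unit (suc i) (suc j) = unit i j

  combination-unit : ∀ {m} i (b : Vector Carrierᴹ m) → combination (unit i) b ≈ᴹ b i
  combination-unit zero    b =
    ≈ᴹ-trans (+ᴹ-cong (*ₗ-identityˡ _) (combination-zero (b ∘ suc) (λ _ → L.refl))) (+ᴹ-identityʳ _)
  combination-unit (suc i) b =
    ≈ᴹ-trans (+ᴹ-cong (*ₗ-zeroˡ _) (combination-unit i (b ∘ suc))) (+ᴹ-identityˡ _)

  span-resp : ∀ {m} (b : Vector Carrierᴹ m) {v w} → v ≈ᴹ w → InSpan b v → InSpan b w
  span-resp b p (a , q) = a , ≈ᴹ-trans (≈ᴹ-sym p) q

  span-generator : ∀ {m} (b : Vector Carrierᴹ m) i → InSpan b (b i)
  span-generator b i = unit i , ≈ᴹ-sym (combination-unit i b)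

  span-+ : ∀ {m} (b : Vector Carrierᴹ m) {v w} → InSpan b v → InSpan b w → InSpan b (v +ᴹ w)
  span-+ b (a , p) (a′ , q) = _ , ≈ᴹ-trans (+ᴹ-cong p q) (≈ᴹ-sym (combination-+ a a′ b))

  span-*ₗ : ∀ {m} (b : Vector Carrierᴹ m) c {v} → InSpan b v → InSpan b (c *ₗ v)
  span-*ₗ b c (a , p) = _ , ≈ᴹ-trans (*ₗ-congˡ p) (≈ᴹ-sym (combination-*ₗ c a b))

  span-sum : ∀ {m k} (b : Vector Carrierᴹ m) (v : Vector Carrierᴹ k) →
             (∀ i → InSpan b (v i)) → InSpan b (sum v)
  span-sum {k = zero}  b v p = _ , ≈ᴹ-sym (combination-zero b (λ _ → L.refl))
  span-sum {k = suc k} b v p = span-+ b (p zero) (span-sum b (v ∘ suc) (p ∘ suc))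

  span-combination : ∀ {m k} (b : Vector Carrierᴹ m) (a : Vector L.Carrier k) (v : Vector Carrierᴹ k) →
                     (∀ i → InSpan b (v i)) → InSpan b (combination a v)
  span-combination b a v p = span-sum b _ (λ i → span-*ₗ b (a i) (p i))

  combination-injective : ∀ {m} {b : Vector Carrierᴹ m} → LinearlyIndependent b →
                          ∀ a a′ → combination a b ≈ᴹ combination a′ b → ∀ i → a i L.≈ a′ i
  combination-injective {b = b} independent a a′ p i = x∙y⁻¹≈ε⇒x≈y _ _ (independent (λ j → a j L.- a′ j) (begin
    combination (λ j → a j L.- a′ j) b                     ≈⟨ combination-+ a _ b ⟩
    combination a b +ᴹ combination (λ j → L.- a′ j) b      ≈⟨ +ᴹ-congʳ p ⟩
    combination a′ b +ᴹ combination (λ j → L.- a′ j) b     ≈⟨ combination-+ a′ _ b ⟨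
    combination (λ j → a′ j L.- a′ j) b                    ≈⟨ combination-zero b (λ j → L.-‿inverseʳ (a′ j)) ⟩
    0ᴹ                                                     ∎) i)
    where open GroupProperties L.+-group using (x∙y⁻¹≈ε⇒x≈y)

  -- The inverse is carried as a function, since a collineation must be given with its inverse;
  -- linearity is asked of `to` only and is derived for `from`.
  record Automorphism : Set ℓ where
    field
      to from   : Carrierᴹ → Carrierᴹ
      to-cong   : ∀ {v w} → v ≈ᴹ w → to v ≈ᴹ to w
      from-cong : ∀ {v w} → v ≈ᴹ w → from v ≈ᴹ from w
      to∘from   : ∀ v → to (from v) ≈ᴹ v
      from∘to   : ∀ v → from (to v) ≈ᴹ v
      to-+      : ∀ v w → to (v +ᴹ w) ≈ᴹ to v +ᴹ to w
      to-*ₗ     : ∀ c v → to (c *ₗ v) ≈ᴹ c *ₗ to v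

    to-0 : to 0ᴹ ≈ᴹ 0ᴹ
    to-0 = ≈ᴹ-trans (to-cong (≈ᴹ-sym (*ₗ-zeroˡ 0ᴹ))) (≈ᴹ-trans (to-*ₗ L.0# 0ᴹ) (*ₗ-zeroˡ _))

    to-combination : ∀ {m} a (b : Vector Carrierᴹ m) → to (combination a b) ≈ᴹ combination a (to ∘ b)
    to-combination {zero}  a b = to-0
    to-combination {suc m} a b = ≈ᴹ-trans (to-+ _ _)
      (+ᴹ-cong (to-*ₗ (a zero) (b zero)) (to-combination (a ∘ suc) (b ∘ suc)))

    to-span : ∀ {m} (b : Vector Carrierᴹ m) {v} → InSpan b v → InSpan (to ∘ b) (to v)
    to-span b (a , p) = a , ≈ᴹ-trans (to-cong p) (to-combination a b)

    inverse : Automorphism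
    inverse = record
      { to = from ; from = to ; to-cong = from-cong ; from-cong = to-cong
      ; to∘from = from∘to ; from∘to = to∘from
      ; to-+ = λ v w → ≈ᴹ-trans
          (from-cong (≈ᴹ-trans (+ᴹ-cong (≈ᴹ-sym (to∘from v)) (≈ᴹ-sym (to∘from w))) (≈ᴹ-sym (to-+ _ _))))
          (from∘to _)
      ; to-*ₗ = λ c v → ≈ᴹ-trans
          (from-cong (≈ᴹ-trans (*ₗ-congˡ (≈ᴹ-sym (to∘from v))) (≈ᴹ-sym (to-*ₗ _ _)))) (from∘to _)
      }

    to-nonzero : ∀ {v} → ¬ v ≈ᴹ 0ᴹ → ¬ to v ≈ᴹ 0ᴹ
    to-nonzero v≉0 p = v≉0 (≈ᴹ-trans (≈ᴹ-sym (from∘to _))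
      (≈ᴹ-trans (from-cong (≈ᴹ-trans p (≈ᴹ-sym to-0))) (from∘to 0ᴹ)))

    toPoint : Point → Point
    toPoint (v , v≉0) = to v , to-nonzero v≉0

    toPoint-cong : ∀ {x y} → x ∼ y → toPoint x ∼ toPoint y
    toPoint-cong ((a , p) , (b , q)) =
      (a , ≈ᴹ-trans (to-cong p) (to-*ₗ a _)) , (b , ≈ᴹ-trans (to-cong q) (to-*ₗ b _))

    isLeftModuleIsomorphism : IsLeftModuleIsomorphism to
    isLeftModuleIsomorphism = record
      { isLeftModuleMonomorphism = record
        { isLeftModuleHomomorphism = record
          { +ᴹ-isGroupHomomorphism = record
            { isMonoidHomomorphism = record
              { isMagmaHomomorphism = record
                { isRelHomomorphism = record { cong = to-cong } ; homo = to-+ }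
              ; ε-homo = to-0
              }
            ; ⁻¹-homo = λ v → inverseˡ-uniqueᴹ _ _
                (≈ᴹ-trans (≈ᴹ-sym (to-+ _ _)) (≈ᴹ-trans (to-cong (-ᴹ‿inverseˡ v)) to-0))
            }
          ; *ₗ-homo = to-*ₗ
          }
        ; injective = λ p → ≈ᴹ-trans (≈ᴹ-sym (from∘to _)) (≈ᴹ-trans (from-cong p) (from∘to _))
        }
      ; surjective = λ v → from v , λ p → ≈ᴹ-trans (to-cong p) (to∘from v)
      }
      where open ModuleProperties V using (inverseˡ-uniqueᴹ)

  open Automorphism using (inverse)

  fromIsomorphism : ∀ {f} → IsLeftModuleIsomorphism f → Automorphism
  fromIsomorphism {f} iso = record
    { to = f
    ; from = λ v → proj₁ (F.surjective v)
    ; to-cong = F.⟦⟧-cong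
    ; from-cong = λ p → F.injective (≈ᴹ-trans (image _) (≈ᴹ-trans p (≈ᴹ-sym (image _))))
    ; to∘from = image
    ; from∘to = λ v → F.injective (image (f v))
    ; to-+ = F.+ᴹ-homo
    ; to-*ₗ = F.*ₗ-homo
    }
    where
    module F = IsLeftModuleIsomorphism iso
    image : ∀ v → f (proj₁ (F.surjective v)) ≈ᴹ v
    image v = proj₂ (F.surjective v) ≈ᴹ-refl

  infixr 9 _∘ᴬ_
  _∘ᴬ_ : Automorphism → Automorphism → Automorphism
  f ∘ᴬ g = record
    { to = f.to ∘ g.to
    ; from = g.from ∘ f.from
    ; to-cong = f.to-cong ∘ g.to-cong
    ; from-cong = g.from-cong ∘ f.from-cong
    ; to∘from = λ v → ≈ᴹ-trans (f.to-cong (g.to∘from _)) (f.to∘from v)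
    ; from∘to = λ v → ≈ᴹ-trans (g.from-cong (f.from∘to _)) (g.from∘to v)
    ; to-+ = λ v w → ≈ᴹ-trans (f.to-cong (g.to-+ v w)) (f.to-+ _ _)
    ; to-*ₗ = λ c v → ≈ᴹ-trans (f.to-cong (g.to-*ₗ c v)) (f.to-*ₗ c _)
    }
    where
    module f = Automorphism f
    module g = Automorphism g

  ≈⇒∼ : ∀ {x y : Point} → proj₁ x ≈ᴹ proj₁ y → x ∼ y
  ≈⇒∼ p = (L.1# , ≈ᴹ-trans p (≈ᴹ-sym (*ₗ-identityˡ _))) ,
          (L.1# , ≈ᴹ-trans (≈ᴹ-sym p) (≈ᴹ-sym (*ₗ-identityˡ _)))

  open Setoid pointSetoid public using () renaming (refl to ∼-refl; sym to ∼-sym; trans to ∼-trans)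

  Respects∼ : PointSet → Set ℓ
  Respects∼ T = ∀ {x y} → x ∼ y → x ∈ T → y ∈ T

  ≐-respects : ∀ {S T : PointSet} → S ≐ T → Respects∼ T → Respects∼ S
  ≐-respects (S⊆T , T⊆S) resp p x∈S = T⊆S (resp p (S⊆T x∈S))

  module _ (f : Automorphism) where
    private
      module f = Automorphism f
      module f⁻¹ = Automorphism (inverse f)

    image-span : ∀ {m} (b : Vector Carrierᴹ m) →
                 pointsOf (InSpan b) ∘ f⁻¹.toPoint ≐ pointsOf (InSpan (f.to ∘ b))
    image-span b =
      (λ {x} v∈ → span-resp (f.to ∘ b) (f.to∘from (proj₁ x)) (f.to-span b v∈)) ,
      (λ (a , p) → a , ≈ᴹ-trans (f.from-cong p) (≈ᴹ-trans (f⁻¹.to-combination a _)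
        (combination-cong (λ _ → L.refl) (λ i → f.from∘to (b i)))))

    image-subspace : ∀ {T} → Geometry.IsSubspace PG T → Geometry.IsSubspace PG (T ∘ f⁻¹.toPoint)
    image-subspace (m , b , T⊆ , ⊆T) = m , f.toPoint ∘ b ,
      (λ {x} x∈ → proj₁ (image-span (proj₁ ∘ b)) {x} (T⊆ x∈)) ,
      (λ {x} x∈ → ⊆T (proj₂ (image-span (proj₁ ∘ b)) {x} x∈))

  collineation : Automorphism → Collineation PG
  collineation f = record
    { bijection = record
      { to        = f.toPoint
      ; from      = f⁻¹.toPoint
      ; to-cong   = λ {x} {y} → f.toPoint-cong {x} {y}
      ; from-cong = λ {x} {y} → f⁻¹.toPoint-cong {x} {y}
      ; inverse   =
          (λ {x} {y} p → ∼-trans {f.toPoint y} {f.toPoint (f⁻¹.toPoint x)} {x} (f.toPoint-cong {y} {f⁻¹.toPoint x} p)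
                           (≈⇒∼ {f.toPoint (f⁻¹.toPoint x)} {x} (f.to∘from _))) ,
          (λ {x} {y} p → ∼-trans {f⁻¹.toPoint y} {f⁻¹.toPoint (f.toPoint x)} {x} (f⁻¹.toPoint-cong {y} {f.toPoint x} p)
                           (≈⇒∼ {f⁻¹.toPoint (f.toPoint x)} {x} (f.from∘to _)))
      }
    ; to-subspace   = image-subspace f
    ; from-subspace = image-subspace (inverse f)
    }
    where
    module f = Automorphism f
    module f⁻¹ = Automorphism (inverse f)

  collineation-isLinear : ∀ f → IsLinear (collineation f)
  collineation-isLinear f = Automorphism.to f , Automorphism.isLeftModuleIsomorphism f ,
    λ _ → L.1# , ≈ᴹ-sym (*ₗ-identityˡ _)

  module Conjugation (f A : Automorphism) where
    private
      module f = Automorphism f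
      module A = Automorphism A

    conjugate : Collineation PG
    conjugate = collineation ((f ∘ᴬ A) ∘ᴬ inverse f)

    conjugate-involutive : (∀ v → A.to (A.to v) ≈ᴹ v) → PowerIsIdentity conjugate 2
    conjugate-involutive involutive p = ≈⇒∼ {Isomorphism.to conjugate (Isomorphism.to conjugate p)} {p}
      (≈ᴹ-trans (f.to-cong (A.to-cong (f.from∘to _))) (≈ᴹ-trans (f.to-cong (involutive _)) (f.to∘from _)))

    conjugate-fixes : ∀ p {v} → A.to v ≈ᴹ v → proj₁ p ≈ᴹ f.to v → Isomorphism.to conjugate p ∼ p
    conjugate-fixes p {v} fixed q = ≈⇒∼ {Isomorphism.to conjugate p} {p} (≈ᴹ-trans
      (f.to-cong (≈ᴹ-trans (A.to-cong (≈ᴹ-trans (f.from-cong q) (f.from∘to v))) fixed)) (≈ᴹ-sym q))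

    -- Applying `f⁻¹` to `f (A v) = c f v` cancels the conjugation. To see that the conjugate is not
    -- the identity it thus suffices to find a vector that is not an eigenvector of `A`.
    fixed⇒eigenvector : ∀ {v} (v≉0 : ¬ f.to v ≈ᴹ 0ᴹ) →
                        Isomorphism.to conjugate (f.to v , v≉0) ∼ (f.to v , v≉0) → ∃[ c ] A.to v ≈ᴹ c *ₗ v
    fixed⇒eigenvector {v} _ ((c , q) , _) = c , (begin
      A.to v                                    ≈⟨ A.to-cong (f.from∘to v) ⟨
      A.to (f.from (f.to v))                    ≈⟨ f.from∘to _ ⟨
      f.from (f.to (A.to (f.from (f.to v))))    ≈⟨ f.from-cong q ⟩
      f.from (c *ₗ f.to v)                      ≈⟨ f.from-cong (f.to-*ₗ c v) ⟨
      f.from (f.to (c *ₗ v))                    ≈⟨ f.from∘to _ ⟩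
      c *ₗ v                                    ∎)

  module _ (inverses : ∀ {c} → ¬ c L.≈ L.0# → ∃[ d ] d L.* c L.≈ L.1#) where

    -- The relation `∼` asks for inclusion both ways. Since `x` is nonzero, so is the scalar, and
    -- inverting it gives the second inclusion. Used over both `𝕂` and `𝔽`.
    scalar⇒∼ : ∀ {x y : Point} c → proj₁ x ≈ᴹ c *ₗ proj₁ y → x ∼ y
    scalar⇒∼ {x , x≉0} {y , _} c p = (c , p) , (proj₁ c⁻¹ , (begin
      y                     ≈⟨ *ₗ-identityˡ y ⟨
      L.1# *ₗ y             ≈⟨ *ₗ-congʳ (proj₂ c⁻¹) ⟨
      (proj₁ c⁻¹ L.* c) *ₗ y ≈⟨ *ₗ-assoc _ _ _ ⟩
      proj₁ c⁻¹ *ₗ c *ₗ y   ≈⟨ *ₗ-congˡ p ⟨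
      proj₁ c⁻¹ *ₗ x        ∎))
      where
      c⁻¹ = inverses λ c≈0 → x≉0 (≈ᴹ-trans p (≈ᴹ-trans (*ₗ-congʳ c≈0) (*ₗ-zeroˡ y)))

    -- On points `κ` agrees with its linear map only up to a scalar that may vary with the point. So
    -- `κ` sends the linear preimage of `x` to a point proportional to `x`, and injectivity of `κ`
    -- on points identifies the two preimages.
    from-linear : (κ : Collineation PG) (linear : IsLinear κ) → ∀ x →
                  Isomorphism.from κ x ∼
                  Automorphism.toPoint (inverse (fromIsomorphism (proj₁ (proj₂ linear)))) x
    from-linear κ (f , iso , lin) x =
      Inverse.inverseʳ (Isomorphism.bijection κ) (∼-sym {Isomorphism.to κ y} {x} to-y∼x)
      where
      y = Automorphism.toPoint (inverse (fromIsomorphism iso)) x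
      to-y∼x : Isomorphism.to κ y ∼ x
      to-y∼x = scalar⇒∼ {Isomorphism.to κ y} {x} (proj₁ (lin y)) (≈ᴹ-trans (proj₂ (lin y))
        (*ₗ-congˡ (Automorphism.to∘from (fromIsomorphism iso) (proj₁ x))))

-- The Frobenius automorphism of `𝔽` over `𝕂` and the trace.

module Galois {ℓ : Level} {q n : ℕ} (ext : FiniteFieldExtension ℓ q n) (2≤n : 2 ≤ n) where

  open FiniteFieldExtension ext using (𝕂; 𝔽; 𝕂-size; 𝔽-size; ι; module ι)
  module K = CommutativeRing (commutativeRing 𝕂)
  module FK = FiniteField 𝕂 𝕂-size
  module FF = FiniteField 𝔽 𝔽-size
  open CommutativeRing (commutativeRing 𝔽) hiding (zero)
  open Endomorphisms ext using (Tr; _⋆_)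
  open CommutativeExp commutativeSemiring using (_^_; ^-congˡ; ^-congʳ; ^-distrib-*; ^-assocʳ)
  open Mult semiring renaming (_×_ to _×ˢ_) using ()
  open Mult K.semiring renaming (_×_ to _×ᴷ_) using ()
  open CommutativeExp K.commutativeSemiring renaming (_^_ to _^ᴷ_) using ()
  open Frobenius commutativeSemiring using (^-zeroˡ; ^-distrib-+)
  open SemiringSum semiring using (sum; sum-cong-≋; sum-init-last; ∑-distrib-+; *-distribˡ-sum)
  open GroupProperties +-group using (x∙y⁻¹≈ε⇒x≈y; x≈y⇒x∙y⁻¹≈ε)
    renaming (∙-cancelˡ to +-cancelˡ)
  open SetoidReasoning setoid

  0<n : 0 < n
  0<n = ℕ.≤-trans (s≤s z≤n) 2≤n

  ι-nonzero : ∀ {a} → ¬ a K.≈ K.0# → ¬ ι a ≈ 0#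
  ι-nonzero {a} a≉0 p with b , q ← FK.inverse a≉0 = FF.0≉1 (begin
    0#         ≈⟨ zeroʳ _ ⟨
    ι b * 0#   ≈⟨ *-congˡ p ⟨
    ι b * ι a  ≈⟨ ι.*-homo b a ⟨
    ι (b K.* a) ≈⟨ ι.⟦⟧-cong q ⟩
    ι K.1#     ≈⟨ ι.1#-homo ⟩
    1#         ∎)

  ι-injective : ∀ {a b} → ι a ≈ ι b → a K.≈ b
  ι-injective {a} {b} p = decidable-stable (a FK.≟ b) λ a≉b → ι-nonzero
    (a≉b ∘ GroupProperties.x∙y⁻¹≈ε⇒x≈y K.+-group a b)
    (trans (ι.+-homo a _) (trans (+-congˡ (ι.-‿homo b)) (x≈y⇒x∙y⁻¹≈ε p)))

  1<q : 1 < q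
  1<q = distinct (FK.0≉1 ∘ FK.index-injective)
    where
    distinct : ∀ {m} {i j : Fin m} → i ≢ j → 1 < m
    distinct {suc zero} {zero} {zero} i≢j = contradiction ≡.refl i≢j
    distinct {suc (suc m)} _ = s≤s (s≤s z≤n)

  q^-mono-< : ∀ {k l} → k < l → q ℕ.^ k < q ℕ.^ l
  q^-mono-< = ℕ.^-monoʳ-< q 1<q

  0<q : 0 < q
  0<q = ℕ.≤-trans (s≤s z≤n) 1<q

  frob : ℕ → Carrier → Carrier
  frob k x = x ^ (q ℕ.^ k)

  σ : Carrier → Carrier
  σ x = x ^ q

  frob-cong : ∀ k {x y} → x ≈ y → frob k x ≈ frob k y
  frob-cong k = ^-congˡ (q ℕ.^ k)

  σ-cong : ∀ {x y} → x ≈ y → σ x ≈ σ y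
  σ-cong = ^-congˡ q

  frob-σ : ∀ k x → frob k (σ x) ≈ frob (suc k) x
  frob-σ k x = ^-assocʳ x q (q ℕ.^ k)

  σ-frob : ∀ k x → σ (frob k x) ≈ frob (suc k) x
  σ-frob k x = trans (^-assocʳ x (q ℕ.^ k) q) (^-congʳ x (ℕ.*-comm (q ℕ.^ k) q))

  -- The inner binomial coefficients of exponent `q` vanish in `𝕂`, which has `q` elements, and `ι`
  -- carries this to `𝔽`. The characteristic never appears.
  σ-+ : ∀ x y → σ (x + y) ≈ σ x + σ y
  σ-+ = ^-distrib-+ 0<q λ k 0<k k<q → begin
    (q C k) ×ˢ 1#        ≈⟨ ι-× (q C k) ⟨
    ι ((q C k) ×ᴷ K.1#)  ≈⟨ ι.⟦⟧-cong (FK.binomial-vanishes k 0<k k<q) ⟩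
    ι K.0#               ≈⟨ ι.0#-homo ⟩
    0#                   ∎
    where
    ι-× : ∀ c → ι (c ×ᴷ K.1#) ≈ c ×ˢ 1#
    ι-× zero    = ι.0#-homo
    ι-× (suc c) = trans (ι.+-homo _ _) (+-cong ι.1#-homo (ι-× c))

  σ-* : ∀ x y → σ (x * y) ≈ σ x * σ y
  σ-* x y = ^-distrib-* x y q

  σ-0 : σ 0# ≈ 0#
  σ-0 = ^-zeroˡ q 0<q

  frob-+ : ∀ k x y → frob k (x + y) ≈ frob k x + frob k y
  frob-+ zero    x y = trans (*-identityʳ _) (sym (+-cong (*-identityʳ x) (*-identityʳ y)))
  frob-+ (suc k) x y = begin
    frob (suc k) (x + y)            ≈⟨ σ-frob k _ ⟨
    σ (frob k (x + y))              ≈⟨ σ-cong (frob-+ k x y) ⟩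
    σ (frob k x + frob k y)         ≈⟨ σ-+ _ _ ⟩
    σ (frob k x) + σ (frob k y)     ≈⟨ +-cong (σ-frob k x) (σ-frob k y) ⟩
    frob (suc k) x + frob (suc k) y ∎

  frob-n : ∀ x → frob n x ≈ x
  frob-n = FF.fermat

  iterate-σ : ∀ k x → iterate σ x k ≈ frob k x
  iterate-σ zero    x = sym (*-identityʳ x)
  iterate-σ (suc k) x = trans (iterate-σ k (σ x)) (frob-σ k x)

  σ⁻¹ : Carrier → Carrier
  σ⁻¹ = frob (ℕ.pred n)

  private
    suc-pred-n : suc (ℕ.pred n) ≡ n
    suc-pred-n = ℕ.suc-pred n ⦃ ℕ.>-nonZero 0<n ⦄

  σ-σ⁻¹ : ∀ x → σ (σ⁻¹ x) ≈ x
  σ-σ⁻¹ x = trans (σ-frob (ℕ.pred n) x) (trans (reflexive (≡.cong (λ k → frob k x) suc-pred-n)) (frob-n x))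

  σ⁻¹-σ : ∀ x → σ⁻¹ (σ x) ≈ x
  σ⁻¹-σ x = trans (frob-σ (ℕ.pred n) x) (trans (reflexive (≡.cong (λ k → frob k x) suc-pred-n)) (frob-n x))

  σ-injective : ∀ {x y} → σ x ≈ σ y → x ≈ y
  σ-injective {x} {y} p =
    trans (sym (σ⁻¹-σ x)) (trans (frob-cong (ℕ.pred n) p) (σ⁻¹-σ y))

  σ-ι : ∀ a → σ (ι a) ≈ ι a
  σ-ι a = trans (sym (ι-^ q)) (ι.⟦⟧-cong (FK.fermat a))
    where
    ι-^ : ∀ m → ι (a ^ᴷ m) ≈ ι a ^ m
    ι-^ zero    = ι.1#-homo
    ι-^ (suc m) = trans (ι.*-homo _ _) (*-congˡ (ι-^ m))

  frob-ι : ∀ k a → frob k (ι a) ≈ ι a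
  frob-ι zero    a = *-identityʳ _
  frob-ι (suc k) a = trans (sym (frob-σ k (ι a))) (trans (frob-cong k (σ-ι a)) (frob-ι k a))

  private
    id-isPolynomial : ∀ {d} → 1 < d → FF.IsPolynomial d (λ x → x)
    id-isPolynomial 1<d with a , p ← FF.^-isPolynomial 1<d = a , λ x → trans (sym (*-identityʳ x)) (p x)

    -- X^d + g(X) with d = qᵏ and deg g < d < |𝔽|
    additive-monic-roots : ∀ {k g} → k < n → FF.IsPolynomial (q ℕ.^ k) g →
                           ¬ (∀ x → frob k x + g x ≈ 0#)
    additive-monic-roots k<n poly root = FF.monic-roots poly
      (λ i → FF.element (inject≤ i (q^-mono-< k<n)))
      (λ p → Fin.inject≤-injective _ _ _ _ (FF.element-injective p))
      (λ i → root _)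

  -- Otherwise the polynomial `X^(q^k) - X`, monic of degree `q^k` because `0 < k`, would vanish on
  -- all `q^n` elements.
  frob-nontrivial : ∀ k → 0 < k → k < n → ∃[ x ] ¬ frob k x ≈ x
  frob-nontrivial k 0<k k<n
    with FF.search (λ p ¬q q → ¬q (trans (frob-cong k p) (trans q (sym p)))) (λ x → ¬? (frob k x FF.≟ x))
  ... | yes found = found
  ... | no none = contradiction
    (λ x → trans (+-congʳ (decidable-stable (frob k x FF.≟ x) (λ ¬p → none (x , ¬p)))) (-‿inverseʳ x))
    (additive-monic-roots k<n (FF.neg-isPolynomial (id-isPolynomial (q^-mono-< 0<k))))

  -- The `q` elements of `ι 𝕂` already exhaust the roots of `X^q - X`; a fixed element outside would
  -- be root number `q + 1`.
  fixed⇒scalar : ∀ {x} → σ x ≈ x → ∃[ a ] x ≈ ι a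
  fixed⇒scalar {x} p with FK.search (λ r s → trans s (ι.⟦⟧-cong r)) (λ a → x FF.≟ ι a)
  ... | yes found = found
  ... | no none = contradiction root
    (FF.monic-roots (FF.neg-isPolynomial (id-isPolynomial 1<q)) r inj)
    where
    r : Fin (suc q) → Carrier
    r zero    = x
    r (suc i) = ι (FK.element i)

    inj : ∀ {i j} → r i ≈ r j → i ≡ j
    inj {zero}  {zero}  _ = ≡.refl
    inj {zero}  {suc j} s = contradiction (_ , s) none
    inj {suc i} {zero}  s = contradiction (_ , sym s) none
    inj {suc i} {suc j} s = ≡.cong suc (FK.element-injective (ι-injective s))

    root : ∀ i → r i ^ q + - r i ≈ 0#
    root zero    = x≈y⇒x∙y⁻¹≈ε p
    root (suc i) = x≈y⇒x∙y⁻¹≈ε (σ-ι _)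

  -- As `2 ≤ n`, some element is moved by `σ`, whereas scalars are fixed. Such an element later
  -- shows that `Φ` is not the identity.
  nonscalar : ∃[ x ] (∀ a → ¬ x ≈ ι a)
  nonscalar with x , ¬p ← frob-nontrivial 1 (s≤s z≤n) 2≤n =
    x , λ a p → ¬p (trans (frob-cong 1 p) (trans (frob-ι 1 a) (sym p)))

  additive-sum : ∀ {h : Carrier → Carrier} → h 0# ≈ 0# → (∀ x y → h (x + y) ≈ h x + h y) →
                 ∀ {m} (f : Vector Carrier m) → h (sum f) ≈ sum (h ∘ f)
  additive-sum h0 h+ {zero}  f = h0
  additive-sum h0 h+ {suc m} f = trans (h+ _ _) (+-congˡ (additive-sum h0 h+ (f ∘ suc)))

  Tr-cong : ∀ {x y} → x ≈ y → Tr x ≈ Tr y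
  Tr-cong p = sum-cong-≋ {n} (λ i → frob-cong (toℕ i) p)

  Tr-+ : ∀ x y → Tr (x + y) ≈ Tr x + Tr y
  Tr-+ x y = trans (sum-cong-≋ {n} (λ i → frob-+ (toℕ i) x y)) (∑-distrib-+ {n} _ _)

  Tr-⋆ : ∀ k x → Tr (k ⋆ x) ≈ k ⋆ Tr x
  Tr-⋆ k x = trans
    (sum-cong-≋ {n} (λ i → trans (^-distrib-* (ι k) x (q ℕ.^ toℕ i)) (*-congʳ (frob-ι (toℕ i) k))))
    (sym (*-distribˡ-sum {n} (ι k) _))

  -- Frobenius shifts the summands of the trace, and `frob n`, being the identity, closes the cycle.
  σ-Tr : ∀ x → σ (Tr x) ≈ Tr x
  σ-Tr x = begin
    σ (Tr x)                                ≈⟨ additive-sum σ-0 σ-+ {n} _ ⟩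
    sum {n} (λ i → σ (frob (toℕ i) x))      ≈⟨ sum-cong-≋ {n} (λ i → σ-frob (toℕ i) x) ⟩
    sum {n} (λ i → frob (suc (toℕ i)) x)    ≈⟨ rotate n (λ i → frob i x) (trans (frob-n x) (sym (*-identityʳ x))) ⟩
    Tr x                                    ∎
    where
    rotate : ∀ m (g : ℕ → Carrier) → g m ≈ g 0 →
             sum {m} (λ i → g (suc (toℕ i))) ≈ sum {m} (λ i → g (toℕ i))
    -- With `g 0` added, the left side is a sum of `m + 1` consecutive terms, which may be split at
    -- its last term instead of its first.
    rotate m g p = +-cancelˡ (g 0) _ _ (begin
      g 0 + sum {m} (λ i → g (suc (toℕ i)))                       ≈⟨ sum-init-last {m} (g ∘ toℕ) ⟩
      sum {m} (λ i → g (toℕ (inject₁ i))) + g (toℕ (fromℕ m))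
        ≈⟨ +-cong (sum-cong-≋ {m} (λ i → reflexive (≡.cong g (toℕ-inject₁ i))))
                  (trans (reflexive (≡.cong g (toℕ-fromℕ m))) p) ⟩
      sum {m} (λ i → g (toℕ i)) + g 0                             ≈⟨ +-comm _ _ ⟩
      g 0 + sum {m} (λ i → g (toℕ i))                             ∎)

  -- The trace regarded as taking its values in `𝕂`.
  tr : Carrier → K.Carrier
  tr x = proj₁ (fixed⇒scalar (σ-Tr x))

  Tr≈ι-tr : ∀ x → Tr x ≈ ι (tr x)
  Tr≈ι-tr x = proj₂ (fixed⇒scalar (σ-Tr x))

  -- As a polynomial the trace is monic of degree `q^(n-1)`, too small for it to vanish on `q^n`
  -- elements.
  Tr-nonzero : ∃[ x ] ¬ Tr x ≈ 0#
  Tr-nonzero with FF.search (λ p ¬q q → ¬q (trans (Tr-cong p) q)) (λ x → ¬? (Tr x FF.≟ 0#))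
  ... | yes found = found
  ... | no none = contradiction
    (λ x → decidable-stable (Tr x FF.≟ 0#) (λ ¬p → none (x , ¬p))) (aux 0<n ℕ.≤-refl)
    where
    -- The number of summands is generalised so that the last one, which is the leading monomial,
    -- can be split off.
    aux : ∀ {m} → 0 < m → m ≤ n → ¬ (∀ x → sum {m} (λ i → frob (toℕ i) x) ≈ 0#)
    aux {suc m} _ m<n vanish = additive-monic-roots {m} m<n
      (FF.sum-isPolynomial {k = m} (λ i → frob (toℕ (inject₁ i))) λ i →
        FF.^-isPolynomial (q^-mono-< (≡.subst (_< m) (≡.sym (toℕ-inject₁ i)) (Fin.toℕ<n i))))
      (λ x → begin
        frob m x + sum {m} (λ i → frob (toℕ (inject₁ i)) x)
          ≈⟨ +-comm _ _ ⟩
        sum {m} (λ i → frob (toℕ (inject₁ i)) x) + frob m x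
          ≈⟨ +-congˡ (reflexive (≡.cong (λ k → frob k x) (toℕ-fromℕ m))) ⟨
        sum {m} (λ i → frob (toℕ (inject₁ i)) x) + frob (toℕ (fromℕ m)) x
          ≈⟨ sum-init-last {m} (λ i → frob (toℕ i) x) ⟨
        sum {suc m} (λ i → frob (toℕ i) x)
          ≈⟨ vanish x ⟩
        0# ∎)

-- The trace form: dual bases and adjoints.

-- A missed value could be punched out of the codomain, leaving an injection into a smaller set.
injective⇒surjective : ∀ {m} (f : Fin m → Fin m) → (∀ {i j} → f i ≡ f j → i ≡ j) → ∀ k → ∃[ i ] f i ≡ k
injective⇒surjective {suc m} f inj k with any? (λ i → f i Fin.≟ k)
... | yes found = found
... | no none = contradiction
  (Fin.injective⇒≤ {f = λ i → punchOut {i = k} (λ p → none (i , ≡.sym p))}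
    (λ p → inj (Fin.punchOut-injective {i = k} _ _ p)))
  ℕ.1+n≰n

module TraceForm {ℓ : Level} {q n : ℕ} (ext : FiniteFieldExtension ℓ q n) (2≤n : 2 ≤ n) where

  open FiniteFieldExtension ext using (𝕂; 𝔽; ι; module ι)
  open Galois ext 2≤n
  open CommutativeRing (commutativeRing 𝔽) hiding (zero)
  open Endomorphisms ext using (Tr; t; _⋆_; 𝔽-over-𝕂; End; 𝔼; _+ᴱ_; _*ᴱ_)
  open SemiringSum semiring using (sum; sum-cong-≋; *-distribʳ-sum)
  open GroupProperties +-group using (x∙y⁻¹≈ε⇒x≈y)
  open Projective 𝕂 𝔽-over-𝕂 using (combination; LinearlyIndependent; InSpan)
  open VectorSpaceLemmas 𝕂 𝔽-over-𝕂
    using (unit; combination-unit; combination-cong; combination-zero; combination-*ₗ; combination-injective)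
  open LeftModule 𝔽-over-𝕂 using (rawLeftModule)
  open LeftModuleMorphisms rawLeftModule rawLeftModule using (IsLeftModuleHomomorphism)
  open ModuleProperties 𝔽-over-𝕂 using (inverseˡ-uniqueᴹ)
  open SetoidReasoning setoid
  private
    module 𝔼 = LeftModule 𝔼
    module Hom = IsLeftModuleHomomorphism

    -- Coordinate vectors of length `m` are numbered by `Fin (q ^ m)`, which turns statements about
    -- dimension into comparisons of cardinalities.
    vector : ∀ m → Fin (q ℕ.^ m) → Vector K.Carrier m
    vector m c = FK.element ∘ finToFun {q} {m} c

    code : ∀ {m} → Vector K.Carrier m → Fin (q ℕ.^ m)
    code a = funToFin (FK.index ∘ a)

    vector∘code : ∀ {m} (a : Vector K.Carrier m) i → vector m (code a) i K.≈ a i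
    vector∘code a i = K.trans (K.reflexive (≡.cong FK.element (Fin.finToFun-funToFin (FK.index ∘ a) i)))
      (FK.element∘index (a i))

    funToFin-cong : ∀ {k m} {f g : Fin m → Fin k} → (∀ i → f i ≡ g i) → funToFin f ≡ funToFin g
    funToFin-cong {m = zero}  p = ≡.refl
    funToFin-cong {m = suc m} p = ≡.cong₂ combine (p zero) (funToFin-cong (p ∘ suc))

    vector-injective : ∀ {m} {c c′ : Fin (q ℕ.^ m)} → (∀ i → vector m c i K.≈ vector m c′ i) → c ≡ c′
    vector-injective {m} {c} {c′} p = ≡.trans (≡.sym (Fin.funToFin-finToFin {m} c))
      (≡.trans (funToFin-cong {q} {m} {finToFun c} {finToFun c′} (FK.element-injective ∘ p))
               (Fin.funToFin-finToFin {m} c′))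

    q^-cancel-≤ : ∀ {k l} → q ℕ.^ k ≤ q ℕ.^ l → k ≤ l
    q^-cancel-≤ p = ℕ.≮⇒≥ λ l<k → ℕ.<⇒≱ (q^-mono-< l<k) p

  span? : ∀ {m} (b : Vector Carrier m) v → Dec (InSpan b v)
  span? {m} b v = map′
    (λ (c , p) → vector m c , p)
    (λ (a , p) → code a , trans p (combination-cong (K.sym ∘ vector∘code a) (λ _ → refl)))
    (any? (λ c → v FF.≟ combination (vector m c) b))

  -- Independence makes the `q^m` combinations distinct, and they lie among `q^n` elements.
  independent⇒≤ : ∀ {m} {b : Vector Carrier m} → LinearlyIndependent b → m ≤ n
  independent⇒≤ {m} {b} independent = q^-cancel-≤ (Fin.injective⇒≤
    {f = λ c → FF.index (combination (vector m c) b)}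
    (λ p → vector-injective {m} (combination-injective independent _ _ (FF.index-injective p))))

  -- A choice of coordinates for each of the `q^n` elements is injective, because the combination
  -- recovers the element.
  spanning⇒≥ : ∀ {m} {b : Vector Carrier m} → (∀ v → InSpan b v) → n ≤ m
  spanning⇒≥ {m} {b} span = q^-cancel-≤ (Fin.injective⇒≤
    {f = λ i → code (proj₁ (span (FF.element i)))} inj)
    where
    inj : ∀ {i j} → code (proj₁ (span (FF.element i))) ≡ code (proj₁ (span (FF.element j))) → i ≡ j
    inj {i} {j} p = FF.element-injective (begin
      FF.element i                                  ≈⟨ recover i ⟩
      combination (vector m (code (a i))) b           ≡⟨ ≡.cong (λ c → combination (vector m c) b) p ⟩
      combination (vector m (code (a j))) b           ≈⟨ recover j ⟨
      FF.element j                                  ∎)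
      where
      a : Fin (q ℕ.^ n) → Vector K.Carrier m
      a i = proj₁ (span (FF.element i))
      recover : ∀ i → FF.element i ≈ combination (vector m (code (a i))) b
      recover i = trans (proj₂ (span (FF.element i)))
        (combination-cong {m} (K.sym ∘ vector∘code (a i)) (λ _ → refl))

  _∷_ : ∀ {m} → Carrier → Vector Carrier m → Vector Carrier (suc m)
  (v ∷ b) zero    = v
  (v ∷ b) (suc i) = b i

  extend : ∀ {m} {b : Vector Carrier m} {v} → LinearlyIndependent b → ¬ InSpan b v →
           LinearlyIndependent (v ∷ b)
  extend {m} {b} {v} independent v∉ a p with a zero FK.≟ K.0#
  ... | yes a₀≈0 = λ where
      zero    → a₀≈0
      (suc i) → independent (a ∘ suc) (begin
        combination (a ∘ suc) b                  ≈⟨ +-identityˡ _ ⟨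
        0# + combination (a ∘ suc) b
          ≈⟨ +-congʳ (trans (*-congʳ (trans (ι.⟦⟧-cong a₀≈0) ι.0#-homo)) (zeroˡ v)) ⟨
        a zero ⋆ v + combination (a ∘ suc) b     ≈⟨ p ⟩
        0#                                       ∎) i
  ... | no a₀≉0 with c , q ← FK.inverse a₀≉0 = contradiction ((λ i → (K.- c) K.* a (suc i)) , (begin
      v                                             ≈⟨ *-identityˡ v ⟨
      1# * v                                        ≈⟨ *-congʳ ι.1#-homo ⟨
      K.1# ⋆ v                                      ≈⟨ *-congʳ (ι.⟦⟧-cong q) ⟨
      (c K.* a zero) ⋆ v                            ≈⟨ V.*ₗ-assoc c _ v ⟩
      c ⋆ (a zero ⋆ v)                              ≈⟨ V.*ₗ-congˡ (inverseˡ-uniqueᴹ _ _ p) ⟩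
      c ⋆ (- combination (a ∘ suc) b)               ≈⟨ RingProperties.-‿distribʳ-* ring _ _ ⟨
      - (c ⋆ combination (a ∘ suc) b)               ≈⟨ RingProperties.-‿distribˡ-* ring _ _ ⟩
      - ι c * combination (a ∘ suc) b               ≈⟨ *-congʳ (ι.-‿homo c) ⟨
      (K.- c) ⋆ combination (a ∘ suc) b             ≈⟨ combination-*ₗ (K.- c) (a ∘ suc) b ⟨
      combination (λ i → (K.- c) K.* a (suc i)) b   ∎)) v∉
      where module V = LeftModule 𝔽-over-𝕂

  -- Greedy construction: as long as `m < n`, a family of `m` vectors cannot span, so the search
  -- finds a vector outside its span.
  independent-family : ∀ m → m ≤ n → Σ[ b ∈ Vector Carrier m ] LinearlyIndependent b
  independent-family zero    _   = (λ ()) , λ _ _ ()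
  independent-family (suc m) m<n with b , independent ← independent-family m (ℕ.<⇒≤ m<n)
    with FF.search (λ p v∉ (a , q) → v∉ (a , trans p q)) (λ v → ¬? (span? b v))
  ... | yes (v , v∉) = v ∷ b , extend independent v∉
  ... | no none = contradiction
    (spanning⇒≥ {b = b} (λ v → decidable-stable (span? b v) (λ v∉ → none (v , v∉)))) (ℕ.<⇒≱ m<n)

  e : Vector Carrier n
  e = proj₁ (independent-family n ℕ.≤-refl)

  e-independent : LinearlyIndependent e
  e-independent = proj₂ (independent-family n ℕ.≤-refl)

  e-span : ∀ v → InSpan e v
  e-span v = decidable-stable (span? e v) λ v∉ → ℕ.1+n≰n (independent⇒≤ {b = v ∷ e} (extend e-independent v∉))

  linear : (f : Carrier → Carrier) → (∀ {x y} → x ≈ y → f x ≈ f y) →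
           (∀ x y → f (x + y) ≈ f x + f y) → (∀ k x → f (k ⋆ x) ≈ k ⋆ f x) → End
  linear f cong add scale = f , record
    { +ᴹ-isGroupHomomorphism = record
      { isMonoidHomomorphism = record
        { isMagmaHomomorphism = record { isRelHomomorphism = record { cong = cong } ; homo = add }
        ; ε-homo = zero-homo
        }
      ; ⁻¹-homo = λ x → inverseˡ-uniqueᴹ _ _
          (trans (sym (add _ _)) (trans (cong (-‿inverseˡ x)) zero-homo))
      }
    ; *ₗ-homo = scale
    }
    where
    zero-homo : f 0# ≈ 0#
    zero-homo = begin
      f 0#          ≈⟨ cong (zeroʳ (ι K.0#)) ⟨
      f (K.0# ⋆ 0#) ≈⟨ scale K.0# 0# ⟩
      K.0# ⋆ f 0#   ≈⟨ *-congʳ ι.0#-homo ⟩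
      0# * f 0#     ≈⟨ zeroˡ _ ⟩
      0#            ∎

  infixr 9 _∘ᴱ_
  _∘ᴱ_ : End → End → End
  (f , F) ∘ᴱ (g , G) = linear (f ∘ g) (Hom.⟦⟧-cong F ∘ Hom.⟦⟧-cong G)
    (λ x y → trans (Hom.⟦⟧-cong F (Hom.+ᴹ-homo G x y)) (Hom.+ᴹ-homo F _ _))
    (λ k x → trans (Hom.⟦⟧-cong F (Hom.*ₗ-homo G k x)) (Hom.*ₗ-homo F _ _))

  *-⋆-comm : ∀ a k x → a * (k ⋆ x) ≈ k ⋆ (a * x)
  *-⋆-comm a k x = trans (sym (*-assoc a (ι k) x)) (trans (*-congʳ (*-comm a (ι k))) (*-assoc (ι k) a x))

  tᴱ : Carrier → End
  tᴱ a = linear (t a) *-congˡ (distribˡ a) (*-⋆-comm a)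

  Trᴱ : End
  Trᴱ = linear Tr Tr-cong Tr-+ Tr-⋆

  combinationᴱ : ∀ {m} (φ : End) a (b : Vector Carrier m) →
                 proj₁ φ (combination a b) ≈ combination a (proj₁ φ ∘ b)
  combinationᴱ {m} (f , F) a b = trans (additive-sum (Hom.0ᴹ-homo F) (Hom.+ᴹ-homo F) {m} _)
    (sum-cong-≋ {m} (λ i → Hom.*ₗ-homo F (a i) (b i)))

  End-ext : ∀ φ ψ → (∀ i → proj₁ φ (e i) ≈ proj₁ ψ (e i)) → φ 𝔼.≈ᴹ ψ
  End-ext φ ψ p x with a , x≈ ← e-span x = begin
    proj₁ φ x                   ≈⟨ Hom.⟦⟧-cong (proj₂ φ) x≈ ⟩
    proj₁ φ (combination a e)   ≈⟨ combinationᴱ φ a e ⟩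
    combination a (proj₁ φ ∘ e) ≈⟨ combination-cong {n} (λ _ → K.refl) p ⟩
    combination a (proj₁ ψ ∘ e) ≈⟨ combinationᴱ ψ a e ⟨
    proj₁ ψ (combination a e)   ≈⟨ Hom.⟦⟧-cong (proj₂ ψ) x≈ ⟨
    proj₁ ψ x                   ∎

  Tr-* : Carrier → End
  Tr-* a = Trᴱ ∘ᴱ tᴱ a

  -- If `a` and `b` differ, then `x = (a - b)⁻¹ y` with `Tr y` nonzero distinguishes the two
  -- functionals.
  nondegenerate : ∀ {a b} → (∀ x → Tr (a * x) ≈ Tr (b * x)) → a ≈ b
  nondegenerate {a} {b} p = decidable-stable (a FF.≟ b) λ a≉b → absurd (a≉b ∘ x∙y⁻¹≈ε⇒x≈y a b)
    where
    absurd : ¬ ¬ a - b ≈ 0#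
    absurd a-b≉0 with c , q ← FF.inverse a-b≉0 | y , Try≉0 ← Tr-nonzero = Try≉0 (begin
      Tr y                                ≈⟨ Tr-cong (*-identityˡ y) ⟨
      Tr (1# * y)                         ≈⟨ Tr-cong (*-congʳ (trans (*-comm (a - b) c) q)) ⟨
      Tr ((a - b) * c * y)                ≈⟨ Tr-cong (*-assoc _ c y) ⟩
      Tr ((a - b) * (c * y))              ≈⟨ Tr-cong (distribʳ _ a (- b)) ⟩
      Tr (a * (c * y) + - b * (c * y))    ≈⟨ Tr-+ _ _ ⟩
      Tr (a * (c * y)) + Tr (- b * (c * y)) ≈⟨ +-congʳ (p _) ⟩
      Tr (b * (c * y)) + Tr (- b * (c * y)) ≈⟨ Tr-+ _ _ ⟨
      Tr (b * (c * y) + - b * (c * y))    ≈⟨ Tr-cong (distribʳ _ b (- b)) ⟨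
      Tr ((b - b) * (c * y))              ≈⟨ Tr-cong (trans (*-congʳ (-‿inverseʳ b)) (zeroˡ _)) ⟩
      Tr 0#                               ≈⟨ Hom.0ᴹ-homo (proj₂ Trᴱ) ⟩
      0#                                  ∎)

  -- The map sending `d` to the values of `Tr (d * _)` on `e` is injective by nondegeneracy. Both
  -- sides have `q^n` elements, so it is surjective: every functional is a trace form.
  represent : (a : Vector K.Carrier n) → ∃[ d ] (∀ i → Tr (d * e i) ≈ ι (a i))
  represent a = FF.element i , λ j → begin
      Tr (FF.element i * e j)         ≈⟨ Tr≈ι-tr _ ⟩
      ι (tr (FF.element i * e j))     ≈⟨ ι.⟦⟧-cong (vector∘code (coordinates i) j) ⟨
      ι (vector n (form i) j)           ≡⟨ ≡.cong (λ c → ι (vector n c j)) p ⟩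
      ι (vector n (code a) j)           ≈⟨ ι.⟦⟧-cong (vector∘code a j) ⟩
      ι (a j)                         ∎
    where
    coordinates : Fin (q ℕ.^ n) → Vector K.Carrier n
    coordinates i j = tr (FF.element i * e j)

    form : Fin (q ℕ.^ n) → Fin (q ℕ.^ n)
    form = code ∘ coordinates

    inj : ∀ {i j} → form i ≡ form j → i ≡ j
    inj {i} {j} p = FF.element-injective (nondegenerate (End-ext (Tr-* _) (Tr-* _) λ k → begin
      Tr (FF.element i * e k)     ≈⟨ Tr≈ι-tr _ ⟩
      ι (coordinates i k)         ≈⟨ ι.⟦⟧-cong (vector∘code (coordinates i) k) ⟨
      ι (vector n (form i) k)       ≡⟨ ≡.cong (λ c → ι (vector n c k)) p ⟩
      ι (vector n (form j) k)       ≈⟨ ι.⟦⟧-cong (vector∘code (coordinates j) k) ⟩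
      ι (coordinates j k)         ≈⟨ Tr≈ι-tr _ ⟨
      Tr (FF.element j * e k)     ∎))

    i = proj₁ (injective⇒surjective form inj (code a))
    p = proj₂ (injective⇒surjective form inj (code a))

  -- the basis dual to e with respect to the trace form
  d : Vector Carrier n
  d i = proj₁ (represent (λ j → unit j i))

  Tr-dual : ∀ i j → Tr (d i * e j) ≈ ι (unit j i)
  Tr-dual i = proj₂ (represent (λ j → unit j i))

  Tr-Tr : ∀ x y → Tr (Tr x * y) ≈ Tr x * Tr y
  Tr-Tr x y = begin
    Tr (Tr x * y)      ≈⟨ Tr-cong (*-congʳ (Tr≈ι-tr x)) ⟩
    Tr (tr x ⋆ y)      ≈⟨ Tr-⋆ (tr x) y ⟩
    tr x ⋆ Tr y        ≈⟨ *-congʳ (Tr≈ι-tr x) ⟨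
    Tr x * Tr y        ∎

  sum-dual : ∀ j (f : Vector Carrier n) → sum (λ i → f i * Tr (d i * e j)) ≈ f j
  sum-dual j f = trans
    (sum-cong-≋ {n} (λ i → trans (*-congˡ (Tr-dual i j)) (*-comm _ _)))
    (combination-unit j f)

  sumᴱ : ∀ {m} → Vector End m → End
  sumᴱ = Sum.sum 𝔼.+ᴹ-commutativeMonoid

  sumᴱ-apply : ∀ {m} (φ : Vector End m) x → proj₁ (sumᴱ φ) x ≈ sum (λ i → proj₁ (φ i) x)
  sumᴱ-apply {zero}  φ x = refl
  sumᴱ-apply {suc m} φ x = +-congˡ (sumᴱ-apply (φ ∘ suc) x)

  -- Both sides are `𝕂`-linear and agree on `e` by duality. Hence the functionals `Tr-* (d i)`
  -- generate `End` over `𝔽`, and the coordinates of `φ` are its values on `e`.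
  expansion : ∀ (φ : End) x → proj₁ φ x ≈ sum (λ i → proj₁ φ (e i) * Tr (d i * x))
  expansion φ x = trans
    (End-ext φ (sumᴱ (λ i → tᴱ (proj₁ φ (e i)) ∘ᴱ Tr-* (d i)))
      (λ j → sym (trans (sumᴱ-apply {n} _ (e j)) (sum-dual j (proj₁ φ ∘ e)))) x)
    (sumᴱ-apply {n} _ x)

  -- the adjoint with respect to the trace form: y ↦ Σᵢ Tr(φ(eᵢ) y) dᵢ
  adjoint : End → End
  adjoint φ = sumᴱ (λ i → tᴱ (d i) ∘ᴱ Tr-* (proj₁ φ (e i)))

  -- By linearity in `x` it is enough to take `x = e j`; duality then leaves only the coefficient
  -- `w j` of `d j` in the adjoint.
  Tr-adjoint : ∀ φ x y → Tr (proj₁ (adjoint φ) y * x) ≈ Tr (y * proj₁ φ x)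
  Tr-adjoint φ x y = End-ext (Tr-* (proj₁ (adjoint φ) y)) (Tr-* y ∘ᴱ φ) (λ j → begin
    Tr (proj₁ (adjoint φ) y * e j)
      ≈⟨ Tr-cong (trans (*-congʳ (sumᴱ-apply {n} _ y)) (*-distribʳ-sum {n} (e j) _)) ⟩
    Tr (sum (λ i → (d i * w i) * e j))
      ≈⟨ additive-sum (Hom.0ᴹ-homo (proj₂ Trᴱ)) Tr-+ {n} _ ⟩
    sum (λ i → Tr ((d i * w i) * e j))
      ≈⟨ sum-cong-≋ {n} (λ i → trans (Tr-cong (trans (*-congʳ (*-comm _ _)) (*-assoc _ _ _))) (Tr-Tr _ _)) ⟩
    sum (λ i → w i * Tr (d i * e j))
      ≈⟨ sum-dual j w ⟩
    w j
      ≈⟨ Tr-cong (*-comm _ _) ⟩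
    Tr (y * proj₁ φ (e j)) ∎) x
    where
    w : Vector Carrier n
    w i = Tr (proj₁ φ (e i) * y)

  -- The adjunction identity determines the adjoint, by nondegeneracy. Its algebraic laws below are
  -- checked through this identity and not through the defining sum.
  adjoint-unique : ∀ φ ψ → (∀ x y → Tr (proj₁ ψ y * x) ≈ Tr (y * proj₁ φ x)) → adjoint φ 𝔼.≈ᴹ ψ
  adjoint-unique φ ψ p y = nondegenerate (λ x → trans (Tr-adjoint φ x y) (sym (p x y)))

  adjoint-cong : ∀ φ ψ → φ 𝔼.≈ᴹ ψ → adjoint φ 𝔼.≈ᴹ adjoint ψ
  adjoint-cong φ ψ p = adjoint-unique φ (adjoint ψ) λ x y →
    trans (Tr-adjoint ψ x y) (Tr-cong (*-congˡ (sym (p x))))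

  adjoint-involutive : ∀ φ → adjoint (adjoint φ) 𝔼.≈ᴹ φ
  adjoint-involutive φ = adjoint-unique (adjoint φ) φ λ x y →
    trans (Tr-cong (*-comm _ x)) (trans (sym (Tr-adjoint φ y x)) (Tr-cong (*-comm _ y)))

  adjoint-+ : ∀ φ ψ → adjoint (φ +ᴱ ψ) 𝔼.≈ᴹ (adjoint φ +ᴱ adjoint ψ)
  adjoint-+ φ ψ = adjoint-unique (φ +ᴱ ψ) (adjoint φ +ᴱ adjoint ψ) λ x y → begin
    Tr ((proj₁ (adjoint φ) y + proj₁ (adjoint ψ) y) * x)
      ≈⟨ trans (Tr-cong (distribʳ x _ _)) (Tr-+ _ _) ⟩
    Tr (proj₁ (adjoint φ) y * x) + Tr (proj₁ (adjoint ψ) y * x)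
      ≈⟨ +-cong (Tr-adjoint φ x y) (Tr-adjoint ψ x y) ⟩
    Tr (y * proj₁ φ x) + Tr (y * proj₁ ψ x)
      ≈⟨ trans (Tr-cong (distribˡ y _ _)) (Tr-+ _ _) ⟨
    Tr (y * (proj₁ φ x + proj₁ ψ x)) ∎

  adjoint-*ᴱ : ∀ k φ → adjoint (k *ᴱ φ) 𝔼.≈ᴹ (k *ᴱ adjoint φ)
  adjoint-*ᴱ k φ = adjoint-unique (k *ᴱ φ) (k *ᴱ adjoint φ) λ x y → begin
    Tr ((k ⋆ proj₁ (adjoint φ) y) * x)   ≈⟨ trans (Tr-cong (*-assoc _ _ x)) (Tr-⋆ k _) ⟩
    k ⋆ Tr (proj₁ (adjoint φ) y * x)     ≈⟨ *-congˡ (Tr-adjoint φ x y) ⟩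
    k ⋆ Tr (y * proj₁ φ x)               ≈⟨ trans (Tr-cong (*-⋆-comm y k _)) (Tr-⋆ k _) ⟨
    Tr (y * (k ⋆ proj₁ φ x))             ∎

  adjoint-t : ∀ a → adjoint (tᴱ a) 𝔼.≈ᴹ tᴱ a
  adjoint-t a = adjoint-unique (tᴱ a) (tᴱ a) λ x y →
    Tr-cong (trans (*-congʳ (*-comm a y)) (*-assoc y a x))

  adjoint-∘ : ∀ φ ψ → adjoint (φ ∘ᴱ ψ) 𝔼.≈ᴹ (adjoint ψ ∘ᴱ adjoint φ)
  adjoint-∘ φ ψ = adjoint-unique (φ ∘ᴱ ψ) (adjoint ψ ∘ᴱ adjoint φ) λ x y →
    trans (Tr-adjoint ψ x _) (Tr-adjoint φ _ y)

  -- Both pairings equal `Tr x * Tr y`, which is symmetric.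
  adjoint-Tr : adjoint Trᴱ 𝔼.≈ᴹ Trᴱ
  adjoint-Tr = adjoint-unique Trᴱ Trᴱ λ x y →
    trans (Tr-Tr y x) (trans (*-comm _ _) (trans (sym (Tr-Tr x y)) (Tr-cong (*-comm _ _))))

  adjoint-automorphism : VectorSpaceLemmas.Automorphism 𝕂 𝔼
  adjoint-automorphism = record
    { to = adjoint
    ; from = adjoint
    ; to-cong = λ {φ} {ψ} → adjoint-cong φ ψ
    ; from-cong = λ {φ} {ψ} → adjoint-cong φ ψ
    ; to∘from = adjoint-involutive
    ; from∘to = adjoint-involutive
    ; to-+ = adjoint-+
    ; to-*ₗ = adjoint-*ᴱ
    }

-- The Desarguesian spread of an `𝔽`-structure and its projective space.

module Spreads {ℓ : Level} {q n : ℕ} (ext : FiniteFieldExtension ℓ q n) (2≤n : 2 ≤ n)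
               (V : VectorSpace (FiniteFieldExtension.𝕂 ext)) where

  open FiniteFieldExtension ext using (𝕂; 𝔽; ι; module ι)
  open Galois ext 2≤n
  open TraceForm ext 2≤n using (e; e-independent; e-span)
  module F = CommutativeRing (commutativeRing 𝔽)
  open LeftModule V
  open Projective 𝕂 V
  open Desarguesian ext V
  open VectorSpaceLemmas 𝕂 V
  open SetoidReasoning ≈ᴹ-setoid

  ≐-∘ : ∀ {a b c} {A : Set a} {B : Set b} {S T : Pred B c} (f : A → B) → S ≐ T → S ∘ f ≐ T ∘ f
  ≐-∘ f (S⊆T , T⊆S) = (λ {x} → S⊆T {f x}) , (λ {x} → T⊆S {f x})

  module Lines (structure : 𝔽-Structure) where
    open 𝔽-Structure structure
    open IsLeftModule ·-isLeftModule using () renaming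
      ( *ₗ-congˡ to ·-congˡ; *ₗ-congʳ to ·-congʳ; *ₗ-assoc to ·-assoc
      ; *ₗ-identityˡ to ·-identityˡ; *ₗ-zeroˡ to ·-zeroˡ; *ₗ-zeroʳ to ·-zeroʳ
      ; *ₗ-distribʳ to ·-distribʳ)
    module W = Projective 𝔽 vectorSpace
    module WL = VectorSpaceLemmas 𝔽 vectorSpace

    private
      scalar⇒∼ᵂ : ∀ {x y : Point} a → proj₁ x ≈ᴹ a · proj₁ y → x W.∼ y
      scalar⇒∼ᵂ {x} {y} = WL.scalar⇒∼ FF.inverse {x} {y}

    ·-nonzero : ∀ {a v} → ¬ v ≈ᴹ 0ᴹ → a · v ≈ᴹ 0ᴹ → a F.≈ F.0#
    ·-nonzero {a} {v} v≉0 p = decidable-stable (a FF.≟ F.0#) λ a≉0 →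
      let c , q = FF.inverse a≉0 in v≉0 (begin
        v             ≈⟨ ·-identityˡ v ⟨
        F.1# · v      ≈⟨ ·-congʳ q ⟨
        (c F.* a) · v ≈⟨ ·-assoc c a v ⟩
        c · (a · v)   ≈⟨ ·-congˡ p ⟩
        c · 0ᴹ        ≈⟨ ·-zeroʳ c ⟩
        0ᴹ            ∎)

    ∼⇒line⊆ : ∀ {x y : Point} → x W.∼ y → line (proj₁ x) ⊆ line (proj₁ y)
    ∼⇒line⊆ ((a , p) , _) (c , q) = c F.* a , ≈ᴹ-trans q (≈ᴹ-trans (·-congˡ p) (≈ᴹ-sym (·-assoc c a _)))

    line-cong : ∀ {x y : Point} → x W.∼ y → line (proj₁ x) ≐ line (proj₁ y)
    line-cong {x} {y} x∼y = (λ {z} → ∼⇒line⊆ {x} {y} x∼y {z}) , (λ {z} → ∼⇒line⊆ {y} {x} (WL.∼-sym {x} {y} x∼y) {z})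

    line-cong≈ : ∀ {v w} → v ≈ᴹ w → line v ≐ line w
    line-cong≈ p = (λ (a , q) → a , ≈ᴹ-trans q (·-congˡ p)) , (λ (a , q) → a , ≈ᴹ-trans q (·-congˡ (≈ᴹ-sym p)))

    self∈line : ∀ v → ∃[ a ] v ≈ᴹ a · v
    self∈line v = F.1# , ≈ᴹ-sym (·-identityˡ v)

    line-injective : ∀ {x y : Point} → line (proj₁ x) ≐ line (proj₁ y) → x W.∼ y
    line-injective {x} {y} (x⊆y , y⊆x) = x⊆y {x} (self∈line _) , y⊆x {y} (self∈line _)

    ∈line⇒≐ : ∀ {x y : Point} → x ∈ line (proj₁ y) → line (proj₁ x) ≐ line (proj₁ y)
    ∈line⇒≐ {x} {y} (a , p) = line-cong {x} {y} (scalar⇒∼ᵂ {x} {y} a p)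

    line-respects : ∀ v → Respects∼ (line v)
    line-respects v (_ , (k , p)) (a , q) = ι k F.* a ,
      ≈ᴹ-trans p (≈ᴹ-trans (*ₗ-congˡ q) (≈ᴹ-trans (≈ᴹ-sym (·-extends k _)) (≈ᴹ-sym (·-assoc _ a v))))

    lines : Pred PointSet ℓ
    lines S = Σ[ v ∈ Point ] S ≐ line (proj₁ v)

    lines-respects : ∀ {S} → S ∈ lines → Respects∼ S
    lines-respects (v , S≐) {x} {y} = ≐-respects S≐ (λ {x} {y} → line-respects (proj₁ v) {x} {y}) {x} {y}

    combination-· : ∀ {m} (a : Vector K.Carrier m) (c : Vector F.Carrier m) v →
                    combination a (λ i → c i · v) ≈ᴹ
                    Projective.combination 𝕂 (Endomorphisms.𝔽-over-𝕂 ext) a c · v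
    combination-· {zero}  a c v = ≈ᴹ-sym (·-zeroˡ v)
    combination-· {suc m} a c v = begin
      a zero *ₗ c zero · v +ᴹ combination (a ∘ suc) (λ i → c (suc i) · v)
        ≈⟨ +ᴹ-cong (≈ᴹ-trans (≈ᴹ-sym (·-extends _ _)) (≈ᴹ-sym (·-assoc _ _ v))) (combination-· (a ∘ suc) (c ∘ suc) v) ⟩
      (ι (a zero) F.* c zero) · v +ᴹ _
        ≈⟨ ·-distribʳ v _ _ ⟨
      Projective.combination 𝕂 (Endomorphisms.𝔽-over-𝕂 ext) a c · v ∎

    -- The map `a ↦ a · v` is `𝕂`-linear and injective, so it carries the basis `e` of `𝔽` to a
    -- basis of the line.
    line-rank : ∀ (v : Point) → IsSubspaceOfRank n (line (proj₁ v))
    line-rank (v , v≉0) = (λ i → e i · v) ,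
      (λ a p → e-independent a (·-nonzero v≉0 (≈ᴹ-trans (≈ᴹ-sym (combination-· a e v)) p))) ,
      (λ (c , p) → proj₁ (e-span c) ,
        ≈ᴹ-trans p (≈ᴹ-trans (·-congʳ (proj₂ (e-span c))) (≈ᴹ-sym (combination-· _ e v)))) ,
      (λ (a , p) → _ , ≈ᴹ-trans p (combination-· a e v))

    lines-isSpread : IsSpread n lines
    lines-isSpread =
      (λ (v , S≐) → let c , independent , line≐ = line-rank v in c , independent , ≐-trans S≐ line≐) ,
      (λ p → line (proj₁ p) , (p , ≐-refl) , self∈line (proj₁ p)) ,
      (λ {_} {_} {p} (v , S≐) (w , T≐) p∈S p∈T →
        ≐-trans S≐ (≐-trans (≐-sym (∈line⇒≐ {p} {v} (proj₁ S≐ p∈S)))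
                   (≐-trans (∈line⇒≐ {p} {w} (proj₁ T≐ p∈T)) (≐-sym T≐))))

    desarguesianSpread : DesarguesianSpread
    desarguesianSpread = record
      { members = lines ; isSpread = lines-isSpread ; structure = structure
      ; arises = λ S → mk⇔ (λ x → x) (λ x → x) }

    Π-Point : Set (Level.suc ℓ)
    Π-Point = Σ[ S ∈ PointSet ] S ∈ lines

    direction : Π-Point → Point
    direction (_ , v , _) = v

    lineOf : Point → Π-Point
    lineOf v = line (proj₁ v) , v , ≐-refl

    combinationᵂ-ι : ∀ {m} (a : Vector K.Carrier m) (c : Vector Carrierᴹ m) →
                     combination a c ≈ᴹ W.combination (ι ∘ a) c
    combinationᵂ-ι {zero}  a c = ≈ᴹ-refl
    combinationᵂ-ι {suc m} a c = +ᴹ-cong (≈ᴹ-sym (·-extends _ _)) (combinationᵂ-ι (a ∘ suc) (c ∘ suc))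

    -- The `𝕂`-span of a union of `𝔽`-lines is closed under `𝔽`, so containing a line means
    -- containing its direction. This translates subspaces of `Π`, defined over `𝕂`, into subspaces
    -- over `𝔽`.
    ⊆SpannedBy⇔∈span : ∀ {m} (G : Vector Π-Point m) S →
                       (proj₁ S ⊆ SpannedBy (⋃ (Fin m) (λ i → proj₁ (G i)))) ⇔
                       W.InSpan (proj₁ ∘ direction ∘ G) (proj₁ (direction S))
    ⊆SpannedBy⇔∈span {m} G (S , v , S≐) = mk⇔
      (λ S⊆ → in-span (S⊆ {v} (proj₂ S≐ {v} (self∈line (proj₁ v)))))
      (λ v∈ {x} x∈S → spanned {x} (multiple v∈ (proj₁ S≐ {x} x∈S)))
      where
      g = proj₁ ∘ direction ∘ G

      multiple : ∀ {u w} → W.InSpan g u → ∃[ a ] w ≈ᴹ a · u → W.InSpan g w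
      multiple u∈ (a , p) = WL.span-resp g (≈ᴹ-sym p) (WL.span-*ₗ g a u∈)

      in-span : v ∈ SpannedBy (⋃ (Fin m) (λ i → proj₁ (G i))) → W.InSpan g (proj₁ v)
      in-span (k , c , c∈ , a , p) = WL.span-resp g
        (≈ᴹ-sym (≈ᴹ-trans p (combinationᵂ-ι a (proj₁ ∘ c))))
        (WL.span-combination g (ι ∘ a) (proj₁ ∘ c) generator)
        where
        generator : ∀ j → W.InSpan g (proj₁ (c j))
        generator j with i , cⱼ∈ ← c∈ j = multiple (WL.span-generator g i) (proj₁ (proj₂ (proj₂ (G i))) {c j} cⱼ∈)

      -- The points of a spanning family must be nonzero, so the summands
      -- with coefficient zero are replaced by generators.
      spanned : ∀ {x} → W.InSpan g (proj₁ x) → x ∈ SpannedBy (⋃ (Fin m) (λ i → proj₁ (G i)))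
      spanned {x} (β , p) = m , proj₁ ∘ summand , (λ i → i , proj₁ (proj₂ (summand i))) ,
        (λ i → proj₁ (proj₂ (proj₂ (summand i)))) ,
        ≈ᴹ-trans p (sum-cong-≋ {m} (λ i → proj₂ (proj₂ (proj₂ (summand i)))))
        where
        open Sum +ᴹ-commutativeMonoid using (sum-cong-≋)
        summand : ∀ i → Σ[ c ∈ Point ] c ∈ proj₁ (G i) × ∃[ k ] β i · g i ≈ᴹ k *ₗ proj₁ c
        summand i with β i FF.≟ F.0#
        ... | yes β≈0 = direction (G i) , proj₂ (proj₂ (proj₂ (G i))) {direction (G i)} (self∈line _) , K.0# ,
          ≈ᴹ-trans (·-congʳ β≈0) (≈ᴹ-trans (·-zeroˡ _) (≈ᴹ-sym (*ₗ-zeroˡ _)))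
        ... | no β≉0 = c , proj₂ (proj₂ (proj₂ (G i))) {c} (β i , ≈ᴹ-refl) , K.1# , ≈ᴹ-sym (*ₗ-identityˡ _)
          where
          c : Point
          c = β i · g i , λ p → β≉0 (·-nonzero (proj₂ (direction (G i))) p)

    projectiveSpace : W.HasDimension n → IsProjectiveSpace desarguesianSpread
    projectiveSpace basis = basis , record
      { bijection = record
        { to = direction
        ; from = lineOf
        ; to-cong = λ {S} {T} → to-cong S T
        ; from-cong = λ {x} {y} → line-cong {x} {y}
        ; inverse = (λ {x} {S} S≐ → to-cong S (lineOf x) S≐) ,
          (λ {S} {x} x∼ → ≐-trans (line-cong {x} {direction S} x∼) (≐-sym (proj₂ (proj₂ S))))
        }
      ; to-subspace = λ (m , G , T⊆ , ⊆T) → m , direction ∘ G ,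
          (λ {x} x∈T → Equivalence.to (⊆SpannedBy⇔∈span G (lineOf x)) (λ {y} → T⊆ {lineOf x} x∈T {y})) ,
          (λ {x} x∈ → ⊆T {lineOf x} (λ {y} → Equivalence.from (⊆SpannedBy⇔∈span G (lineOf x)) x∈ {y}))
      ; from-subspace = λ (m , c , T⊆ , ⊆T) → m , lineOf ∘ c ,
          (λ {S} v∈T {y} → Equivalence.from (⊆SpannedBy⇔∈span (lineOf ∘ c) S) (T⊆ {direction S} v∈T) {y}) ,
          (λ {S} S⊆ → ⊆T {direction S} (Equivalence.to (⊆SpannedBy⇔∈span (lineOf ∘ c) S) (λ {y} → S⊆ {y})))
      } , (λ S → proj₂ (proj₂ S))
      where
      to-cong : ∀ S T → proj₁ S ≐ proj₁ T → direction S W.∼ direction T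
      to-cong (S , v , S≐) (T , w , T≐) S≐T =
        line-injective {v} {w} (≐-trans (≐-sym S≐) (≐-trans S≐T T≐))

-- Semilinear maps on a spread, and the subgeometry fixed by a coordinatewise Frobenius map.

module Subgeometries {ℓ : Level} {q n : ℕ} (ext : FiniteFieldExtension ℓ q n) (2≤n : 2 ≤ n)
                     (V : VectorSpace (FiniteFieldExtension.𝕂 ext))
                     (structure : Desarguesian.𝔽-Structure ext V) where

  open FiniteFieldExtension ext using (𝕂; ι; module ι)
  open Galois ext 2≤n
  open LeftModule V
  open Projective 𝕂 V
  open Desarguesian ext V
  open VectorSpaceLemmas 𝕂 V
  open Spreads ext 2≤n V
  open Lines structure
  open 𝔽-Structure structure
  open LeftModule vectorSpace using () renaming
    (*ₗ-congˡ to ·-congˡ; *ₗ-congʳ to ·-congʳ)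
  open SetoidReasoning ≈ᴹ-setoid

  -- The automorphism is linear over `𝕂`, hence acts on the points of `PG`; its semilinearity over
  -- `𝔽`, recorded in both directions, makes it permute the lines and lets `flip` exchange the roles
  -- of the map and its inverse.
  record Semilinear : Set ℓ where
    field
      automorphism : Automorphism
      τ τ⁻¹        : F.Carrier → F.Carrier
    open Automorphism automorphism public
    field
      to-·   : ∀ a v → to (a · v) ≈ᴹ τ a · to v
      from-· : ∀ a v → from (a · v) ≈ᴹ τ⁻¹ a · from v

    to-combinationᵂ : ∀ {m} a (c : Vector Carrierᴹ m) →
                      to (W.combination a c) ≈ᴹ W.combination (τ ∘ a) (to ∘ c)
    to-combinationᵂ {zero}  a c = to-0
    to-combinationᵂ {suc m} a c = ≈ᴹ-trans (to-+ _ _)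
      (+ᴹ-cong (to-· (a zero) (c zero)) (to-combinationᵂ (a ∘ suc) (c ∘ suc)))

    to-spanᵂ : ∀ {m} (c : Vector Carrierᴹ m) {v} → W.InSpan c v → W.InSpan (to ∘ c) (to v)
    to-spanᵂ c (a , p) = _ , ≈ᴹ-trans (to-cong p) (to-combinationᵂ a c)

  flip : Semilinear → Semilinear
  flip f = record
    { automorphism = Automorphism.inverse f.automorphism
    ; τ = f.τ⁻¹ ; τ⁻¹ = f.τ ; to-· = f.from-· ; from-· = f.to-· }
    where module f = Semilinear f

  module _ (f : Semilinear) where
    private
      module f = Semilinear f
      module f⁻¹ = Semilinear (flip f)

    image-line : ∀ v → line v ∘ f⁻¹.toPoint ≐ line (f.to v)
    image-line v =
      (λ {x} (a , p) → f.τ a , ≈ᴹ-trans (≈ᴹ-sym (f.to∘from (proj₁ x))) (≈ᴹ-trans (f.to-cong p) (f.to-· a v))) ,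
      (λ {x} (a , p) → f.τ⁻¹ a , ≈ᴹ-trans (f.from-cong p) (≈ᴹ-trans (f.from-· a _) (·-congˡ (f.from∘to v))))

    image : Π-Point → Π-Point
    image (S , v , S≐) = S ∘ f⁻¹.toPoint , f.toPoint v , ≐-trans (≐-∘ f⁻¹.toPoint S≐) (image-line (proj₁ v))

    -- Images of generators generate the image. The preimage of `S` enters as any member whose
    -- direction is the pulled-back vector, so that the same statement, read for `flip f`, also
    -- treats preimages of subspaces.
    image-subspaceᵂ : ∀ {T} → Geometry.IsSubspace (Π desarguesianSpread) T →
                      ∃[ m ] Σ[ G ∈ Vector Π-Point m ]
                      (∀ S → (S∘f : Π-Point) → proj₁ (direction S∘f) ≈ᴹ f.from (proj₁ (direction S)) →
                       S∘f ∈ T ⇔ (proj₁ S ⊆ SpannedBy (⋃ (Fin m) (λ i → proj₁ (G i)))))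
    image-subspaceᵂ (m , G , T⊆ , ⊆T) = m , image ∘ G , λ S S∘f p → mk⇔
      (λ S∘f∈T {x} → Equivalence.from (⊆SpannedBy⇔∈span (image ∘ G) S)
        (WL.span-resp (f.to ∘ g) (≈ᴹ-trans (f.to-cong p) (f.to∘from _))
          (f.to-spanᵂ g (Equivalence.to (⊆SpannedBy⇔∈span G S∘f) (λ {y} → T⊆ {S∘f} S∘f∈T {y})))) {x})
      (λ S⊆ → ⊆T {S∘f} (λ {y} → Equivalence.from (⊆SpannedBy⇔∈span G S∘f)
        (WL.span-resp g (≈ᴹ-sym p) (span-from (Equivalence.to (⊆SpannedBy⇔∈span (image ∘ G) S) S⊆))) {y}))
      where
      g = proj₁ ∘ direction ∘ G
      span-from : ∀ {v} → W.InSpan (f.to ∘ g) v → W.InSpan g (f.from v)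
      span-from v∈ with a , p ← f⁻¹.to-spanᵂ (f.to ∘ g) v∈ =
        a , ≈ᴹ-trans p (WL.combination-cong (λ _ → F.refl) (λ i → f.from∘to (g i)))

    image∘flip : ∀ S → proj₁ S ∘ Automorphism.toPoint f.automorphism ∘ f⁻¹.toPoint ≐ proj₁ S
    image∘flip (S , S∈) =
      (λ {x} → lines-respects S∈ {f.toPoint (f⁻¹.toPoint x)} {x}
        (≈⇒∼ {f.toPoint (f⁻¹.toPoint x)} {x} (f.to∘from _))) ,
      (λ {x} → lines-respects S∈ {x} {f.toPoint (f⁻¹.toPoint x)}
        (≈⇒∼ {x} {f.toPoint (f⁻¹.toPoint x)} (≈ᴹ-sym (f.to∘from _))))

  maps-lines : (f : Semilinear) → MapsFamily (collineation (Semilinear.automorphism f)) lines lines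
  maps-lines f = (λ {S} S∈ → proj₂ (image f (S , S∈))) ,
    (λ {S} S∈ → _ , proj₂ (image (flip f) (S , S∈)) , ≐-sym (image∘flip f (S , S∈)))

  induced : Semilinear → Collineation (Π desarguesianSpread)
  induced f = record
    { bijection = record
      { to = image f
      ; from = image (flip f)
      ; to-cong = λ {S} {T} → ≐-∘ f⁻¹.toPoint
      ; from-cong = λ {S} {T} → ≐-∘ f.toPoint
      ; inverse =
          (λ {S} {T} p → ≐-trans (≐-∘ f⁻¹.toPoint p) (image∘flip f S)) ,
          (λ {S} {T} p → ≐-trans (≐-∘ f.toPoint p) (image∘flip (flip f) S))
      }
    ; to-subspace = λ {T} sub → let m , G , crit = image-subspaceᵂ f {T} sub in m , G ,
        (λ {S} S∈ {x} → Equivalence.to (crit S (image (flip f) S) ≈ᴹ-refl) S∈ {x}) ,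
        (λ {S} S⊆ → Equivalence.from (crit S (image (flip f) S) ≈ᴹ-refl) S⊆)
    ; from-subspace = λ {T} sub → let m , G , crit = image-subspaceᵂ (flip f) {T} sub in m , G ,
        (λ {S} S∈ {x} → Equivalence.to (crit S (image f S) ≈ᴹ-refl) S∈ {x}) ,
        (λ {S} S⊆ → Equivalence.from (crit S (image f S) ≈ᴹ-refl) S⊆)
    }
    where
    module f = Semilinear f
    module f⁻¹ = Semilinear (flip f)

  iterate-image : ∀ f k S → let open Semilinear f in
                  proj₁ (iterate (image f) S k) ≐ line (iterate to (proj₁ (direction S)) k)
  iterate-image f zero    S = proj₂ (proj₂ S)
  iterate-image f (suc k) S = iterate-image f k (image f S)

  module Frame (b : Vector Carrierᴹ n) (b-independent : W.LinearlyIndependent b)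
               (b-span : ∀ v → W.InSpan b v) where

    coordinate : Carrierᴹ → Vector F.Carrier n
    coordinate v = proj₁ (b-span v)

    expansion : ∀ v → v ≈ᴹ W.combination (coordinate v) b
    expansion v = proj₂ (b-span v)

    coordinate-unique : ∀ {v a} → v ≈ᴹ W.combination a b → ∀ i → coordinate v i F.≈ a i
    coordinate-unique {v} p =
      WL.combination-injective b-independent _ _ (≈ᴹ-trans (≈ᴹ-sym (expansion v)) p)

    combination-congˡ : ∀ {a a′ : Vector F.Carrier n} → (∀ i → a i F.≈ a′ i) →
                        W.combination a b ≈ᴹ W.combination a′ b
    combination-congˡ {a} {a′} p = WL.combination-cong {n} {a} {a′} p (λ _ → ≈ᴹ-refl)

    private
      -- The `τ`-semilinear map fixing the basis `b`. It is built for general `τ` because both `σ`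
      -- and `σ⁻¹` are needed, as a map and its inverse.
      module Coordinatewise (τ : F.Carrier → F.Carrier)
        (τ-cong : ∀ {x y} → x F.≈ y → τ x F.≈ τ y)
        (τ-+ : ∀ x y → τ (x F.+ y) F.≈ τ x F.+ τ y)
        (τ-* : ∀ x y → τ (x F.* y) F.≈ τ x F.* τ y) where

        map : Carrierᴹ → Carrierᴹ
        map v = W.combination (τ ∘ coordinate v) b

        map-combination : ∀ {v a} → v ≈ᴹ W.combination a b → map v ≈ᴹ W.combination (τ ∘ a) b
        map-combination p = combination-congˡ (λ i → τ-cong (coordinate-unique p i))

        map-cong : ∀ {v w} → v ≈ᴹ w → map v ≈ᴹ map w
        map-cong p = map-combination (≈ᴹ-trans p (expansion _))

        map-+ : ∀ v w → map (v +ᴹ w) ≈ᴹ map v +ᴹ map w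
        map-+ v w = ≈ᴹ-trans
          (map-combination (≈ᴹ-trans (+ᴹ-cong (expansion v) (expansion w)) (≈ᴹ-sym (WL.combination-+ _ _ b))))
          (≈ᴹ-trans (combination-congˡ (λ i → τ-+ (coordinate v i) (coordinate w i))) (WL.combination-+ _ _ b))

        map-· : ∀ a v → map (a · v) ≈ᴹ τ a · map v
        map-· a v = ≈ᴹ-trans
          (map-combination (≈ᴹ-trans (·-congˡ (expansion v)) (≈ᴹ-sym (WL.combination-*ₗ a _ b))))
          (≈ᴹ-trans (combination-congˡ (λ i → τ-* a (coordinate v i))) (WL.combination-*ₗ _ _ b))

      -- By injectivity of `σ` the claim may be checked after applying `σ`. The operation is left
      -- open to cover both addition and multiplication.
      σ⁻¹-hom : (_∙_ : F.Carrier → F.Carrier → F.Carrier) →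
                (∀ {x x′ y y′} → x F.≈ x′ → y F.≈ y′ → (x ∙ y) F.≈ (x′ ∙ y′)) →
                (∀ x y → σ (x ∙ y) F.≈ (σ x ∙ σ y)) → ∀ x y → σ⁻¹ (x ∙ y) F.≈ (σ⁻¹ x ∙ σ⁻¹ y)
      σ⁻¹-hom _∙_ cong hom x y = σ-injective (F.trans (σ-σ⁻¹ _)
        (F.sym (F.trans (hom _ _) (cong (σ-σ⁻¹ x) (σ-σ⁻¹ y)))))

      module S = Coordinatewise σ σ-cong σ-+ σ-*
      module S⁻¹ = Coordinatewise σ⁻¹ (frob-cong (ℕ.pred n))
        (σ⁻¹-hom F._+_ F.+-cong σ-+) (σ⁻¹-hom F._*_ F.*-cong σ-*)

    frobenius : Semilinear
    frobenius = record
      { automorphism = record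
        { to = S.map
        ; from = S⁻¹.map
        ; to-cong = S.map-cong
        ; from-cong = S⁻¹.map-cong
        ; to∘from = λ v → ≈ᴹ-trans (S.map-combination ≈ᴹ-refl)
            (≈ᴹ-trans (combination-congˡ (λ i → σ-σ⁻¹ (coordinate v i))) (≈ᴹ-sym (expansion v)))
        ; from∘to = λ v → ≈ᴹ-trans (S⁻¹.map-combination ≈ᴹ-refl)
            (≈ᴹ-trans (combination-congˡ (λ i → σ⁻¹-σ (coordinate v i))) (≈ᴹ-sym (expansion v)))
        ; to-+ = S.map-+
        -- Scalars of `𝕂` act through `ι`, whose values `σ` fixes; so the map is linear over `𝕂`
        -- although only semilinear over `𝔽`.
        ; to-*ₗ = λ k v → ≈ᴹ-trans (S.map-cong (≈ᴹ-sym (·-extends k v)))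
            (≈ᴹ-trans (S.map-· (ι k) v) (≈ᴹ-trans (·-congʳ (σ-ι k)) (·-extends k _)))
        }
      ; τ = σ
      ; τ⁻¹ = σ⁻¹
      ; to-· = S.map-·
      ; from-· = S⁻¹.map-·
      }

    private
      module φ = Semilinear frobenius
      𝒟 = desarguesianSpread
      ξ = induced frobenius

      image≐ : ∀ S → proj₁ (image frobenius S) ≐ line (φ.to (proj₁ (direction S)))
      image≐ S = proj₂ (proj₂ (image frobenius S))

    iterate-frobenius : ∀ k {v a} → v ≈ᴹ W.combination a b →
                        iterate φ.to v k ≈ᴹ W.combination (frob k ∘ a) b
    iterate-frobenius zero {v} {a} p =
      ≈ᴹ-trans p (combination-congˡ (λ i → F.sym (F.*-identityʳ (a i))))
    iterate-frobenius (suc k) {v} {a} p = ≈ᴹ-trans (iterate-frobenius k (S.map-combination p))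
      (combination-congˡ (λ i → frob-σ k (a i)))

    isSemilinear : IsSemilinear 𝒟 ξ
    isSemilinear = σ , φ.to ,
      record
        { isRingMonomorphism = record
          { isRingHomomorphism = record
            { isSemiringHomomorphism = record
              { isNearSemiringHomomorphism = record
                { +-isMonoidHomomorphism = record
                  { isMagmaHomomorphism = record
                    { isRelHomomorphism = record { cong = σ-cong } ; homo = σ-+ }
                  ; ε-homo = σ-0
                  }
                ; *-homo = σ-*
                }
              ; 1#-homo = Frobenius.1^ F.commutativeSemiring q
              }
            ; -‿homo = λ x → GroupProperties.inverseˡ-unique F.+-group _ _
                (F.trans (F.sym (σ-+ _ _)) (F.trans (σ-cong (F.-‿inverseˡ x)) σ-0))
            }
          ; injective = σ-injective
          }
        ; surjective = λ y → σ⁻¹ y , λ p → F.trans (σ-cong p) (σ-σ⁻¹ y)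
        } ,
      IsLeftModuleIsomorphism.+ᴹ-isGroupIsomorphism φ.isLeftModuleIsomorphism ,
      φ.to-· ,
      λ S → (λ {x} x∈ → Automorphism.toPoint (inverse φ.automorphism) x , x∈ , ≈ᴹ-sym (φ.to∘from _)) ,
            (λ {x} (v , v∈ , p) → lines-respects (proj₂ S) {v} {Automorphism.toPoint (inverse φ.automorphism) x}
              (≈⇒∼ {v} {Automorphism.toPoint (inverse φ.automorphism) x}
                (≈ᴹ-trans (≈ᴹ-sym (φ.from∘to _)) (φ.from-cong (≈ᴹ-sym p)))) v∈)
      where
      open Automorphism using (inverse)
      open LeftModuleMorphisms rawLeftModule rawLeftModule using (module IsLeftModuleIsomorphism)

    hasOrder : HasOrder ξ n
    hasOrder = 0<n , power-n , power-k
      where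
      power-n : PowerIsIdentity ξ n
      power-n S@(_ , v , _) = ≐-trans (iterate-image frobenius n S) (≐-trans
        (line-cong≈ {iterate φ.to (proj₁ v) n} {proj₁ v} (≈ᴹ-trans (iterate-frobenius n (expansion (proj₁ v)))
          (≈ᴹ-trans (combination-congˡ (λ i → frob-n (coordinate (proj₁ v) i))) (≈ᴹ-sym (expansion (proj₁ v))))))
        (≐-sym (proj₂ (proj₂ S))))

      two-indices : ∀ {m} → 2 ≤ m → Σ[ i ∈ Fin m ] Σ[ j ∈ Fin m ] j ≢ i
      two-indices (s≤s (s≤s _)) = zero , suc zero , λ ()

      -- A vector with coordinates 1 and a, where σᵏ(a) ≠ a, is not proportional to its image.
      power-k : ∀ k → 0 < k → k < n → ¬ PowerIsIdentity ξ k
      power-k k 0<k k<n power with a , moved ← frob-nontrivial k 0<k k<n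
                              | i , j , j≢i ← two-indices 2≤n =
          let c , v≈ = fixed (power (lineOf v)) in absurd c v≈
        where
        α : Vector F.Carrier n
        α l with l Fin.≟ i
        ... | yes _ = F.1#
        ... | no _  = a

        αi≈1 : α i F.≈ F.1#
        αi≈1 with i Fin.≟ i
        ... | yes _   = F.refl
        ... | no i≢i = contradiction ≡.refl i≢i

        αj≈a : α j F.≈ a
        αj≈a with j Fin.≟ i
        ... | yes j≡i = contradiction j≡i j≢i
        ... | no _    = F.refl

        v : Point
        v = W.combination α b , λ p → FF.0≉1 (F.trans (F.sym (b-independent α p i)) αi≈1)

        fixed : proj₁ (iterate (image frobenius) (lineOf v) k) ≐ line (proj₁ v) →
                ∃[ c ] proj₁ v ≈ᴹ c · iterate φ.to (proj₁ v) k
        fixed p = proj₁ (≐-trans (≐-sym p) (iterate-image frobenius k (lineOf v))) {v} (self∈line _)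

        -- Coordinate `i`, equal to 1, forces `c` to be 1; coordinate `j` then says that `a` is
        -- fixed by `frob k`.
        absurd : ∀ c → ¬ proj₁ v ≈ᴹ c · iterate φ.to (proj₁ v) k
        absurd c p = moved (F.trans (F.sym (F.*-identityˡ _)) (F.trans (F.*-congʳ (F.sym c≈1))
          (F.trans (F.*-congˡ (frob-cong k (F.sym αj≈a))) (F.trans (F.sym (eq j)) αj≈a))))
          where
          eq : ∀ l → α l F.≈ c F.* frob k (α l)
          eq = WL.combination-injective b-independent α (λ l → c F.* frob k (α l)) (≈ᴹ-trans p (≈ᴹ-trans
            (·-congˡ (iterate-frobenius k {a = α} ≈ᴹ-refl)) (≈ᴹ-sym (WL.combination-*ₗ c _ b))))
          c≈1 : c F.≈ F.1#
          c≈1 = F.trans (F.sym (F.*-identityʳ c)) (F.trans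
            (F.*-congˡ (F.sym (F.trans (frob-cong k αi≈1) (Frobenius.1^ F.commutativeSemiring (q ℕ.^ k)))))
            (F.trans (F.sym (eq i)) αi≈1))

    module _ (ℛ : Pred PointSet ℓ)
             (ℛ-lines : ∀ S → S ∈ ℛ ⇔ (Σ[ u ∈ Point ] u ∈ pointsOf (InSpan b) × S ≐ line (proj₁ u))) where

      isSubgeometry : IsSubgeometry 𝒟 ℛ
      isSubgeometry = b , independent , b-span , ℛ-lines
        where
        independent : LinearlyIndependent b
        independent a p i = ι-injective (F.trans
          (b-independent (ι ∘ a) (≈ᴹ-trans (≈ᴹ-sym (combinationᵂ-ι a b)) p) i) (F.sym ι.0#-homo))

      -- If σ(v) = c v, rescaling v so that one coordinate becomes 1 forces
      -- all its coordinates to be fixed by σ.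
      fixed⇒∈span : ∀ {v c} → ¬ v ≈ᴹ 0ᴹ → φ.to v ≈ᴹ c · v →
                    Σ[ u ∈ Point ] u ∈ pointsOf (InSpan b) × ∃[ y ] proj₁ u ≈ᴹ y · v
      fixed⇒∈span {v} {c} v≉0 p = (u , u≉0) , (k , u≈) , y , ≈ᴹ-refl
        where
        x : Vector F.Carrier n
        x = coordinate v

        nonzero : ∃[ j ] ¬ x j F.≈ F.0#
        nonzero = Fin.¬∀⟶∃¬ n (λ i → x i F.≈ F.0#) (λ i → x i FF.≟ F.0#)
          (λ x≈0 → v≉0 (≈ᴹ-trans (expansion v) (WL.combination-zero {n} {x} b x≈0)))

        j : Fin n
        j = proj₁ nonzero

        y : F.Carrier
        y = proj₁ (FF.inverse (proj₂ nonzero))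

        yxⱼ≈1 : (y F.* x j) F.≈ F.1#
        yxⱼ≈1 = proj₂ (FF.inverse (proj₂ nonzero))

        u : Carrierᴹ
        u = y · v

        u-expansion : u ≈ᴹ W.combination (λ i → y F.* x i) b
        u-expansion = ≈ᴹ-trans (·-congˡ (expansion v)) (≈ᴹ-sym (WL.combination-*ₗ y x b))

        u≉0 : ¬ u ≈ᴹ 0ᴹ
        u≉0 q = FF.0≉1 (F.trans (F.sym (b-independent (λ i → y F.* x i) (≈ᴹ-trans (≈ᴹ-sym u-expansion) q) j)) yxⱼ≈1)

        σx : ∀ i → σ (x i) F.≈ c F.* x i
        σx = WL.combination-injective b-independent (σ ∘ x) (λ i → c F.* x i)
          (≈ᴹ-trans p (≈ᴹ-trans (·-congˡ (expansion v)) (≈ᴹ-sym (WL.combination-*ₗ c x b))))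

        σyx : ∀ i → σ (y F.* x i) F.≈ (σ y F.* c) F.* x i
        σyx i = F.trans (σ-* y (x i)) (F.trans (F.*-congˡ (σx i)) (F.sym (F.*-assoc _ _ _)))

        -- Coordinate `j` of `y · v` is 1 and therefore fixed by `σ`; comparing it with its image
        -- and cancelling `x j` gives the relation, which then fixes the remaining coordinates.
        y≈σy*c : σ y F.* c F.≈ y
        y≈σy*c = FF.*-cancelˡ-nonzero (proj₂ nonzero) (F.trans (F.*-comm _ _) (F.trans (F.sym (σyx j))
          (F.trans (σ-cong yxⱼ≈1) (F.trans (Frobenius.1^ F.commutativeSemiring q)
            (F.trans (F.sym yxⱼ≈1) (F.*-comm _ _))))))

        fixed : ∀ i → ∃[ k ] (y F.* x i) F.≈ ι k
        fixed i = fixed⇒scalar (F.trans (σyx i) (F.*-congʳ y≈σy*c))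

        k : Vector K.Carrier n
        k i = proj₁ (fixed i)

        u≈ : u ≈ᴹ combination k b
        u≈ = ≈ᴹ-trans u-expansion (≈ᴹ-trans
          (combination-congˡ (λ i → proj₂ (fixed i))) (≈ᴹ-sym (combinationᵂ-ι k b)))

      fixed-line : ∀ {S} (v : Point) → S ≐ line (proj₁ v) → line (φ.to (proj₁ v)) ≐ S → S ∈ ℛ
      fixed-line {S} v S≐ p = in-ℛ (fixed⇒∈span (proj₂ v) (proj₂ fixed))
        where
        fixed : ∃[ c ] φ.to (proj₁ v) ≈ᴹ c · proj₁ v
        fixed = proj₁ (≐-trans p S≐) {φ.toPoint v} (self∈line _)

        in-ℛ : (Σ[ u ∈ Point ] u ∈ pointsOf (InSpan b) × ∃[ y ] proj₁ u ≈ᴹ y · proj₁ v) → S ∈ ℛ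
        in-ℛ (u , u∈ , u∈v) = Equivalence.from (ℛ-lines S) (u , u∈ , ≐-trans S≐ (≐-sym (∈line⇒≐ {u} {v} u∈v)))

      line-fixed : ∀ {S} → S ∈ ℛ → ∀ v → S ≐ line v → line (φ.to v) ≐ S
      line-fixed {S} S∈ℛ v S≐ = fixed (Equivalence.to (ℛ-lines S) S∈ℛ)
        where
        f⁻¹ = Semilinear.toPoint (flip frobenius)
        fixed : (Σ[ u ∈ Point ] u ∈ pointsOf (InSpan b) × S ≐ line (proj₁ u)) → line (φ.to v) ≐ S
        fixed ((u , _) , (k , u≈) , S≐u) = ≐-trans (≐-sym (image-line frobenius v))
          (≐-trans (≐-∘ f⁻¹ (≐-trans (≐-sym S≐) S≐u))
          (≐-trans (image-line frobenius u) (≐-trans (line-cong≈ {φ.to u} {u} su≈u) (≐-sym S≐u))))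
          where
          u-expansion : u ≈ᴹ W.combination (ι ∘ k) b
          u-expansion = ≈ᴹ-trans u≈ (combinationᵂ-ι k b)
          su≈u : φ.to u ≈ᴹ u
          su≈u = ≈ᴹ-trans (S.map-combination u-expansion)
            (≈ᴹ-trans (combination-congˡ (λ i → σ-ι (k i))) (≈ᴹ-sym u-expansion))

      fixedPoints : FixedPointsAre 𝒟 ξ ℛ
      fixedPoints S = mk⇔
        (λ p → fixed-line (direction S) (proj₂ (proj₂ S)) (≐-trans (≐-sym (image≐ S)) p))
        (λ S∈ℛ → ≐-trans (image≐ S) (line-fixed S∈ℛ (proj₁ (direction S)) (proj₂ (proj₂ S))))

      inducesSemilinearFixing : Σ[ Ξ ∈ Collineation PG ] InducesSemilinearFixing 𝒟 ℛ Ξ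
      inducesSemilinearFixing = collineation φ.automorphism , collineation-isLinear φ.automorphism ,
        maps-lines frobenius , ξ , (λ S → ≐-refl) , isSemilinear , hasOrder , fixedPoints

-- Transport of an `𝔽`-structure along a `𝕂`-automorphism.

module Transport {ℓ : Level} {q n : ℕ} (ext : FiniteFieldExtension ℓ q n) (2≤n : 2 ≤ n)
                 (V : VectorSpace (FiniteFieldExtension.𝕂 ext))
                 (structure : Desarguesian.𝔽-Structure ext V)
                 (g : VectorSpaceLemmas.Automorphism (FiniteFieldExtension.𝕂 ext) V) where

  open FiniteFieldExtension ext using (𝕂; 𝔽)
  open Galois ext 2≤n
  open LeftModule V
  open Projective 𝕂 V
  open Desarguesian ext V
  open VectorSpaceLemmas 𝕂 V
  open Spreads ext 2≤n V
  private
    module Std = 𝔽-Structure structure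
    module StdW = LeftModule Std.vectorSpace
    module g = Automorphism g
    module g⁻¹ = Automorphism (Automorphism.inverse g)

  -- The structure for which `g` is `𝔽`-linear from the given one, so that its lines are the
  -- `g`-images of the given lines. It extends the action of `𝕂` because `g` is `𝕂`-linear.
  transported : 𝔽-Structure
  transported = record
    { _·_ = λ a v → g.to (a Std.· g.from v)
    ; ·-isLeftModule = record
      { isLeftSemimodule = record
        { +ᴹ-isCommutativeMonoid = +ᴹ-isCommutativeMonoid
        ; isPreleftSemimodule = record
          { *ₗ-cong      = λ p r → g.to-cong (StdW.*ₗ-cong p (g.from-cong r))
          ; *ₗ-zeroˡ     = λ v → ≈ᴹ-trans (g.to-cong (StdW.*ₗ-zeroˡ _)) g.to-0
          ; *ₗ-distribʳ  = λ v a b → ≈ᴹ-trans (g.to-cong (StdW.*ₗ-distribʳ _ a b)) (g.to-+ _ _)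
          ; *ₗ-identityˡ = λ v → ≈ᴹ-trans (g.to-cong (StdW.*ₗ-identityˡ _)) (g.to∘from v)
          ; *ₗ-assoc     = λ a b v → g.to-cong (≈ᴹ-trans (StdW.*ₗ-assoc a b _)
                             (StdW.*ₗ-congˡ (≈ᴹ-sym (g.from∘to _))))
          ; *ₗ-zeroʳ     = λ a → ≈ᴹ-trans (g.to-cong (≈ᴹ-trans (StdW.*ₗ-congˡ g⁻¹.to-0) (StdW.*ₗ-zeroʳ a))) g.to-0
          ; *ₗ-distribˡ  = λ a v w → ≈ᴹ-trans
                             (g.to-cong (≈ᴹ-trans (StdW.*ₗ-congˡ (g⁻¹.to-+ v w)) (StdW.*ₗ-distribˡ a _ _)))
                             (g.to-+ _ _)
          }
        }
      ; -ᴹ‿cong = -ᴹ‿cong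
      ; -ᴹ‿inverse = -ᴹ‿inverse
      }
    ; ·-extends = λ k v → ≈ᴹ-trans (g.to-cong (Std.·-extends k _))
        (≈ᴹ-trans (g.to-*ₗ k _) (*ₗ-congˡ (g.to∘from v)))
    }

  open 𝔽-Structure transported
  private
    module W = Projective 𝔽 vectorSpace
    module StdP = Projective 𝔽 Std.vectorSpace

  ·-to : ∀ a v → a · g.to v ≈ᴹ g.to (a Std.· v)
  ·-to a v = g.to-cong (StdW.*ₗ-congˡ (g.from∘to v))

  combination-to : ∀ {m} a (b : Vector Carrierᴹ m) →
                   W.combination a (g.to ∘ b) ≈ᴹ g.to (StdP.combination a b)
  combination-to {zero}  a b = ≈ᴹ-sym g.to-0
  combination-to {suc m} a b = ≈ᴹ-trans
    (+ᴹ-cong (·-to (a zero) (b zero)) (combination-to (a ∘ suc) (b ∘ suc))) (≈ᴹ-sym (g.to-+ _ _))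

  independent-to : ∀ {m} {b : Vector Carrierᴹ m} → StdP.LinearlyIndependent b →
                   W.LinearlyIndependent (g.to ∘ b)
  independent-to {m} {b} independent a p = independent a (≈ᴹ-trans (≈ᴹ-sym (g.from∘to _))
    (≈ᴹ-trans (g.from-cong (≈ᴹ-trans (≈ᴹ-sym (combination-to a b)) p)) g⁻¹.to-0))

  span-to : ∀ {m} {b : Vector Carrierᴹ m} → (∀ v → StdP.InSpan b v) → ∀ v → W.InSpan (g.to ∘ b) v
  span-to {m} {b} span v = proj₁ (span (g.from v)) , ≈ᴹ-trans (≈ᴹ-sym (g.to∘from v))
    (≈ᴹ-trans (g.to-cong (proj₂ (span (g.from v)))) (≈ᴹ-sym (combination-to _ b)))

  line-to : ∀ v → line (g.to v) ≐ pointsOf (λ w → ∃[ a ] w ≈ᴹ g.to (a Std.· v))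
  line-to v = (λ (a , p) → a , ≈ᴹ-trans p (·-to a v)) , (λ (a , p) → a , ≈ᴹ-trans p (≈ᴹ-sym (·-to a v)))

module Transports {ℓ : Level} {q n : ℕ} (ext : FiniteFieldExtension ℓ q n) (2≤n : 2 ≤ n)
                  (V : VectorSpace (FiniteFieldExtension.𝕂 ext))
                  (structure : Desarguesian.𝔽-Structure ext V)
                  (g h : VectorSpaceLemmas.Automorphism (FiniteFieldExtension.𝕂 ext) V) where

  open LeftModule V
  open Projective (FiniteFieldExtension.𝕂 ext) V
  open Desarguesian ext V
  open VectorSpaceLemmas (FiniteFieldExtension.𝕂 ext) V
  open Spreads ext 2≤n V
  private
    module Std = 𝔽-Structure structure
    module StdW = LeftModule Std.vectorSpace
    module g = Automorphism g
    module h = Automorphism h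
    open Automorphism using (inverse; toPoint)
    module Gᵗ = Transport ext 2≤n V structure g
    module Hᵗ = Transport ext 2≤n V structure h
    module Gˢ = 𝔽-Structure Gᵗ.transported
    module Hˢ = 𝔽-Structure Hᵗ.transported
    Φ = h ∘ᴬ inverse g
    module Φ = Automorphism Φ

  -- Both `g` and `h` are `𝔽`-linear out of the original structure, so `h ∘ᴬ inverse g` is
  -- `𝔽`-linear between the two transported ones.
  intertwines : ∀ a v → Φ.to (a Gˢ.· v) ≈ᴹ a Hˢ.· Φ.to v
  intertwines a v = h.to-cong (≈ᴹ-trans (g.from∘to _) (StdW.*ₗ-congˡ (≈ᴹ-sym (h.from∘to _))))

  private
    image-line : ∀ v → Gˢ.line v ∘ toPoint (inverse Φ) ≐ Hˢ.line (Φ.to v)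
    image-line v =
      (λ {x} (a , p) → a , ≈ᴹ-trans (≈ᴹ-sym (Φ.to∘from (proj₁ x))) (≈ᴹ-trans (Φ.to-cong p) (intertwines a v))) ,
      (λ {x} (a , p) → a , ≈ᴹ-trans (Φ.from-cong (≈ᴹ-trans p (≈ᴹ-sym (intertwines a v)))) (Φ.from∘to _))

  maps-lines : MapsFamily (collineation Φ) (Lines.lines Gᵗ.transported) (Lines.lines Hᵗ.transported)
  maps-lines =
    (λ (v , S≐) → toPoint Φ v , ≐-trans (≐-∘ (toPoint (inverse Φ)) S≐) (image-line (proj₁ v))) ,
    (λ (w , T≐) → Gˢ.line (Φ.from (proj₁ w)) , (toPoint (inverse Φ) w , ≐-refl) ,
      ≐-trans T≐ (≐-sym (≐-trans (image-line (Φ.from (proj₁ w)))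
        (Lines.line-cong≈ Hᵗ.transported {Φ.to (Φ.from (proj₁ w))} {proj₁ w} (Φ.to∘from _)))))

-- The spreads of endomorphisms and their relation to the two systems of the Segre variety.

module EndomorphismSpreads {ℓ : Level} {q n : ℕ} (ext : FiniteFieldExtension ℓ q n) (2≤n : 2 ≤ n) where

  open FiniteFieldExtension ext using (𝕂; 𝔽; ι; module ι)
  open Galois ext 2≤n
  open TraceForm ext 2≤n
  open CommutativeRing (commutativeRing 𝔽) hiding (zero)
  open Endomorphisms ext
  open VectorSpaceLemmas 𝕂 𝔼
  open Spreads ext 2≤n 𝔼 using (≐-∘; module Lines)
  open SemiringSum semiring using (sum; sum-cong-≋)
  open Automorphism using (inverse)
  private
    module 𝔼 = LeftModule 𝔼

  standard : 𝔽-Structure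
  standard = record
    { _·_ = λ a φ → tᴱ a ∘ᴱ φ
    ; ·-isLeftModule = record
      { isLeftSemimodule = record
        { +ᴹ-isCommutativeMonoid = 𝔼.+ᴹ-isCommutativeMonoid
        ; isPreleftSemimodule = record
          { *ₗ-cong      = λ p r x → *-cong p (r x)
          ; *ₗ-zeroˡ     = λ φ x → zeroˡ _
          ; *ₗ-distribʳ  = λ φ a b x → distribʳ _ a b
          ; *ₗ-identityˡ = λ φ x → *-identityˡ _
          ; *ₗ-assoc     = λ a b φ x → *-assoc a b _
          ; *ₗ-zeroʳ     = λ a x → zeroʳ a
          ; *ₗ-distribˡ  = λ a φ ψ x → distribˡ a _ _
          }
        }
      ; -ᴹ‿cong = λ p x → -‿cong (p x)
      ; -ᴹ‿inverse = 𝔼.-ᴹ‿inverse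
      }
    ; ·-extends = λ k φ x → refl
    }

  module StdW = Projective 𝔽 (𝔽-Structure.vectorSpace standard)

  combination-apply : ∀ {m} (a : Vector Carrier m) (φ : Vector End m) x →
                      proj₁ (StdW.combination a φ) x ≈ sum (λ i → a i * proj₁ (φ i) x)
  combination-apply {zero}  a φ x = refl
  combination-apply {suc m} a φ x = +-congˡ (combination-apply (a ∘ suc) (φ ∘ suc) x)

  dual : Vector End n
  dual i = Tr-* (d i)

  dual-independent : StdW.LinearlyIndependent dual
  dual-independent a p j = trans (sym (sum-dual j a)) (trans (sym (combination-apply {n} a dual (e j))) (p (e j)))

  dual-span : ∀ φ → StdW.InSpan dual φ
  dual-span φ = proj₁ φ ∘ e , λ x → trans (expansion φ x) (sym (combination-apply {n} _ dual x))

  represented : (a : Vector K.Carrier n) → ∃[ μ ] StdW.combination (ι ∘ a) dual 𝔼.≈ᴹ Tr-* μ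
  represented a = μ , λ x → begin
    proj₁ (StdW.combination (ι ∘ a) dual) x   ≈⟨ combination-apply {n} (ι ∘ a) dual x ⟩
    sum {n} (λ i → ι (a i) * Tr (d i * x))
      ≈⟨ sum-cong-≋ {n} (λ i → trans (sym (Tr-⋆ (a i) _)) (Tr-cong (sym (*-assoc _ _ x)))) ⟩
    sum {n} (λ i → Tr ((ι (a i) * d i) * x))  ≈⟨ additive-sum (Hom.0ᴹ-homo (proj₂ Trᴱ)) Tr-+ {n} _ ⟨
    Tr (sum {n} (λ i → (ι (a i) * d i) * x))  ≈⟨ Tr-cong (*-distribʳ-sum {n} x _) ⟨
    Tr (μ * x)                                ∎
    where
    open SetoidReasoning setoid
    open SemiringSum semiring using (*-distribʳ-sum)
    module Hom = LeftModuleMorphisms.IsLeftModuleHomomorphism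
    μ = sum {n} (λ i → ι (a i) * d i)

  Tr-*-nonzero : ∀ {μ} → NonZero μ → ¬ Tr-* μ 𝔼.≈ᴹ 0ᴱ
  Tr-*-nonzero μ≉0 p = μ≉0 (nondegenerate (λ x → trans (p x) (sym (trans (Tr-cong (zeroˡ x)) (0ᴹ-homo (proj₂ Trᴱ))))))
    where open LeftModuleMorphisms.IsLeftModuleHomomorphism

  -- For the families used here the parameter 0 gives the zero map, which is not a point, so it need
  -- not be excluded.
  Image : Automorphism → (Carrier → End) → PointSet
  Image g h = pointsOf (λ φ → ∃[ a ] φ 𝔼.≈ᴹ Automorphism.to g (h a))

  -- Common treatment of both spreads. The properties involving `ℛ` are derived from its description
  -- by `g`-images of left families alone.
  module Carried (g : Automorphism) where
    private
      module g = Automorphism g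
      module T = Transport ext 2≤n 𝔼 standard g
      module L = Lines T.transported
      module S = Subgeometries ext 2≤n 𝔼 T.transported

    𝒟 : DesarguesianSpread
    𝒟 = L.desarguesianSpread

    basis : Vector End n
    basis = g.to ∘ dual

    private
      module B = S.Frame basis (T.independent-to dual-independent) (T.span-to dual-span)

    isProjectiveSpace : IsProjectiveSpace 𝒟
    isProjectiveSpace = L.projectiveSpace (basis , T.independent-to dual-independent , T.span-to dual-span)

    ∈members : ∀ {S ψ} → ¬ ψ 𝔼.≈ᴹ 0ᴱ → S ≐ Image g (λ a → tᴱ a ∘ᴱ ψ) → S ∈ members 𝒟
    ∈members {S} {ψ} ψ≉0 S≐ = (g.to ψ , g.to-nonzero ψ≉0) , ≐-trans S≐ (≐-sym (T.line-to ψ))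

    module _ (ℛ : Pred PointSet ℓ)
             (characterisation : ∀ S → S ∈ ℛ ⇔
               (∃[ μ ] NonZero μ × S ≐ Image g (λ a → tᴱ a ∘ᴱ Tr-* μ))) where

      open SetoidReasoning 𝔼.≈ᴹ-setoid
      private
        ∈span⇒ : ∀ {φ} → InSpan basis φ → ∃[ μ ] φ 𝔼.≈ᴹ g.to (Tr-* μ)
        ∈span⇒ {φ} (k , p) = proj₁ (represented k) , (begin
          φ                                            ≈⟨ p ⟩
          combination k basis                          ≈⟨ L.combinationᵂ-ι k basis ⟩
          L.W.combination (ι ∘ k) basis                ≈⟨ T.combination-to (ι ∘ k) dual ⟩
          g.to (StdW.combination (ι ∘ k) dual)         ≈⟨ g.to-cong (proj₂ (represented k)) ⟩
          g.to (Tr-* (proj₁ (represented k)))          ∎)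

        span⇐ : ∀ μ → InSpan basis (g.to (Tr-* μ))
        span⇐ μ = k , (begin
          g.to (Tr-* μ)                                ≈⟨ g.to-cong expand ⟩
          g.to (StdW.combination (ι ∘ k) dual)         ≈⟨ T.combination-to (ι ∘ k) dual ⟨
          L.W.combination (ι ∘ k) basis                ≈⟨ L.combinationᵂ-ι k basis ⟨
          combination k basis                          ∎)
          where
          -- By `expansion` the coordinates of a functional are its values on `e`; here they are
          -- traces and so lie in `𝕂`.
          k : Vector K.Carrier n
          k i = tr (μ * e i)
          expand : Tr-* μ 𝔼.≈ᴹ StdW.combination (ι ∘ k) dual
          expand x = trans (expansion (Tr-* μ) x) (trans
            (sum-cong-≋ {n} (λ i → *-congʳ (Tr≈ι-tr (μ * e i)))) (sym (combination-apply {n} (ι ∘ k) dual x)))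

        ℛ-lines : ∀ S → S ∈ ℛ ⇔ (Σ[ u ∈ Point ]
                  u ∈ pointsOf (InSpan basis) × S ≐ 𝔽-Structure.line T.transported (proj₁ u))
        ℛ-lines S = mk⇔
          (λ S∈ → let μ , μ≉0 , S≐ = Equivalence.to (characterisation S) S∈ in
            (g.to (Tr-* μ) , g.to-nonzero (Tr-*-nonzero μ≉0)) , span⇐ μ , ≐-trans S≐ (≐-sym (T.line-to (Tr-* μ))))
          (λ (u , u∈ , S≐) → let μ , u≈ = ∈span⇒ {proj₁ u} u∈ in Equivalence.from (characterisation S)
            (μ , nonzero u μ u≈ ,
             ≐-trans S≐ (≐-trans (L.line-cong≈ {proj₁ u} {g.to (Tr-* μ)} u≈) (T.line-to (Tr-* μ)))))
          where
          open LeftModuleMorphisms.IsLeftModuleHomomorphism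
          zero-form : ∀ {μ} → μ ≈ 0# → Tr-* μ 𝔼.≈ᴹ 0ᴱ
          zero-form p x = trans (Tr-cong (trans (*-congʳ p) (zeroˡ x))) (0ᴹ-homo (proj₂ Trᴱ))
          nonzero : ∀ (u : Point) μ → proj₁ u 𝔼.≈ᴹ g.to (Tr-* μ) → NonZero μ
          nonzero (u , u≉0) μ u≈ μ≈0 = u≉0 (begin
            u              ≈⟨ u≈ ⟩
            g.to (Tr-* μ)  ≈⟨ g.to-cong (zero-form μ≈0) ⟩
            g.to 0ᴱ        ≈⟨ g.to-0 ⟩
            0ᴱ             ∎)

      isSubgeometry : IsSubgeometry 𝒟 ℛ
      isSubgeometry = B.isSubgeometry ℛ ℛ-lines

      inducesSemilinearFixing : Σ[ Ξ ∈ Collineation PG ] InducesSemilinearFixing 𝒟 ℛ Ξ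
      inducesSemilinearFixing = B.inducesSemilinearFixing ℛ ℛ-lines

      ⊆members : ℛ ⊆ members 𝒟
      ⊆members {S} S∈ = let μ , μ≉0 , S≐ = Equivalence.to (characterisation S) S∈ in
        ∈members {S} {Tr-* μ} (Tr-*-nonzero μ≉0) S≐

  -- The common shape of `ℐ` and of the members of `ℛ₁` and `ℛ₂`. The law `scale` moves a scalar of
  -- `𝕂` into the parameter, which is what makes point sets given up to proportionality manageable.
  record Family : Set ℓ where
    field
      map   : Carrier → End
      scale : ∀ k a → (k *ᴱ map a) 𝔼.≈ᴹ map (ι k * a)
      map-0 : ∀ {a} → a ≈ 0# → map a 𝔼.≈ᴹ 0ᴱ

    generated : PointSet
    generated p = ∃[ a ] NonZero a × p Is⟨ proj₁ (map a) ⟩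

    -- The scalar hidden in `∼` is absorbed by `scale`; conversely, a point is nonzero, which forces
    -- a nonzero parameter.
    generated≐ : generated ≐ pointsOf (λ φ → ∃[ a ] φ 𝔼.≈ᴹ map a)
    generated≐ =
      (λ (a , _ , r , r≈ , (k , p) , _) → ι k * a , λ x → trans (p x) (trans (*-congˡ (r≈ x)) (scale k a x))) ,
      (λ {p} (a , p≈) → a , (λ a≈0 → proj₂ p (λ x → trans (p≈ x) (map-0 a≈0 x))) , p , p≈ , ∼-refl {p})

  open Family using (generated; generated≐)

  diagonal : Family
  diagonal = record
    { map = tᴱ
    ; scale = λ k a x → sym (*-assoc (ι k) a x)
    ; map-0 = λ p x → trans (*-congʳ p) (zeroˡ x)
    }

  left right : Carrier → Family
  left μ = record
    { map = λ a → tᴱ a ∘ᴱ Tr-* μ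
    ; scale = λ k a x → sym (*-assoc (ι k) a _)
    ; map-0 = λ p x → trans (*-congʳ p) (zeroˡ _)
    }
  right μ = record
    { map = λ a → tᴱ μ ∘ᴱ Tr-* a
    ; scale = λ k a x → trans (sym (*-⋆-comm μ k _))
        (*-congˡ (trans (sym (Tr-⋆ k _)) (Tr-cong (sym (*-assoc (ι k) a x)))))
    ; map-0 = λ p x → trans (*-congˡ (trans (Tr-cong (trans (*-congʳ p) (zeroˡ x))) Tr-0)) (zeroʳ μ)
    }
    where
    Tr-0 : Tr 0# ≈ 0#
    Tr-0 = LeftModuleMorphisms.IsLeftModuleHomomorphism.0ᴹ-homo (proj₂ Trᴱ)

  adjoint-Tr-* : ∀ μ → adjoint (Tr-* μ) 𝔼.≈ᴹ (tᴱ μ ∘ᴱ Trᴱ)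
  adjoint-Tr-* μ x = trans (adjoint-∘ Trᴱ (tᴱ μ) x) (trans (adjoint-t μ _) (*-congˡ (adjoint-Tr x)))

  adjoint-left : ∀ μ a → adjoint (Family.map (left μ) a) 𝔼.≈ᴹ Family.map (right μ) a
  adjoint-left μ a x = trans (adjoint-∘ (tᴱ a) (Tr-* μ) x)
    (trans (adjoint-Tr-* μ _) (*-congˡ (Tr-cong (adjoint-t a x))))

  module _ (κ : Collineation PG) (linear : IsLinear κ) where

    linearPart : Automorphism
    linearPart = fromIsomorphism (proj₁ (proj₂ linear))

    private
      module f = Automorphism linearPart
      module f⁻¹ = Automorphism (inverse linearPart)

    -- The inverse of `κ` differs from that of its linear part by a scalar depending on the point,
    -- and `scale` absorbs it.
    image-family : ∀ (h : Family) → κ ⟦ generated h ⟧ ≐ Image linearPart (Family.map h)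
    image-family h = ≐-trans (≐-∘ (Isomorphism.from κ) (generated≐ h)) ((λ {p} → forth p) , (λ {p} → back p))
      where
      open Family h using (map; scale)
      open SetoidReasoning 𝔼.≈ᴹ-setoid
      forth : ∀ p → ∃[ a ] proj₁ (Isomorphism.from κ p) 𝔼.≈ᴹ map a → ∃[ a ] proj₁ p 𝔼.≈ᴹ f.to (map a)
      forth p (a , q) = let c , r = proj₂ (from-linear FK.inverse κ linear p) in ι c * a , (begin
        proj₁ p                                           ≈⟨ f.to∘from (proj₁ p) ⟨
        f.to (f.from (proj₁ p))                           ≈⟨ f.to-cong r ⟩
        f.to (c *ᴱ proj₁ (Isomorphism.from κ p))
          ≈⟨ f.to-cong (𝔼.*ₗ-congˡ {c} {proj₁ (Isomorphism.from κ p)} {map a} q) ⟩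
        f.to (c *ᴱ map a)                                 ≈⟨ f.to-cong (scale c a) ⟩
        f.to (map (ι c * a))                              ∎)
      back : ∀ p → ∃[ a ] proj₁ p 𝔼.≈ᴹ f.to (map a) → ∃[ a ] proj₁ (Isomorphism.from κ p) 𝔼.≈ᴹ map a
      back p (a , q) = let c , r = proj₁ (from-linear FK.inverse κ linear p) in ι c * a , (begin
        proj₁ (Isomorphism.from κ p)       ≈⟨ r ⟩
        c *ᴱ f.from (proj₁ p)
          ≈⟨ 𝔼.*ₗ-congˡ {c} {f.from (proj₁ p)} {f.from (f.to (map a))} (f.from-cong q) ⟩
        c *ᴱ f.from (f.to (map a))         ≈⟨ 𝔼.*ₗ-congˡ {c} {f.from (f.to (map a))} {map a} (f.from∘to (map a)) ⟩
        c *ᴱ map a                         ≈⟨ scale c a ⟩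
        map (ι c * a)                      ∎)

    -- Here membership in the group of the Segre variety is used. Every member of `ℛ` is the image
    -- of a member, which gives one direction; images of members are members, which gives the other.
    characterisation : ∀ (h : Carrier → Family) {ℛ : Pred PointSet ℓ} →
      (∀ S → S ∈ ℛ ⇔ (∃[ μ ] NonZero μ × S ≐ generated (h μ))) → MapsFamily κ ℛ ℛ →
      ∀ S → S ∈ ℛ ⇔ (∃[ μ ] NonZero μ × S ≐ Image linearPart (Family.map (h μ)))
    characterisation h {ℛ} ℛ-def (maps , onto) S = mk⇔
      (λ S∈ → let T , T∈ , S≐ = onto S∈ ; μ , μ≉0 , T≐ = Equivalence.to (ℛ-def T) T∈ in
        μ , μ≉0 , ≐-trans S≐ (≐-trans (≐-∘ (Isomorphism.from κ) T≐) (image-family (h μ))))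
      (λ (μ , μ≉0 , S≐) →
        let ν , ν≉0 , T≐ = Equivalence.to (ℛ-def (κ ⟦ generated (h μ) ⟧))
                             (maps (Equivalence.from (ℛ-def (generated (h μ))) (μ , μ≉0 , ≐-refl))) in
        Equivalence.from (ℛ-def S) (ν , ν≉0 , ≐-trans S≐ (≐-trans (≐-sym (image-family (h μ))) T≐)))

  Image-cong : ∀ g g′ {h h′} → (∀ a → Automorphism.to g (h a) 𝔼.≈ᴹ Automorphism.to g′ (h′ a)) →
               Image g h ≐ Image g′ h′
  Image-cong g g′ p = (λ (a , q) → a , λ x → trans (q x) (p a x)) , (λ (a , q) → a , λ x → trans (q x) (sym (p a x)))

-- The two spreads through a given subspace and the involution exchanging them.

module Construction {ℓ : Level} {q n : ℕ} (ext : FiniteFieldExtension ℓ q n) (2≤n : 2 ≤ n)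
                    (κ : Collineation (Endomorphisms.PG ext)) (κ∈H : Endomorphisms.IsInH ext κ) where

  open FiniteFieldExtension ext using (𝕂; 𝔽; ι; module ι)
  open Galois ext 2≤n
  open TraceForm ext 2≤n
  open CommutativeRing (commutativeRing 𝔽) hiding (zero)
  open Endomorphisms ext
  open VectorSpaceLemmas 𝕂 𝔼
  open EndomorphismSpreads ext 2≤n
  open Automorphism using (inverse)
  private
    module 𝔼 = LeftModule 𝔼

  f g : Automorphism
  f = linearPart κ (proj₁ κ∈H)
  g = f ∘ᴬ adjoint-automorphism

  private
    module f = Automorphism f
    module g = Automorphism g

  module 𝒟₁ = Carried f
  module 𝒟₂ = Carried g

  ℛ₁-image : ∀ S → S ∈ ℛ₁ ⇔ (∃[ μ ] NonZero μ × S ≐ Image f (λ a → tᴱ a ∘ᴱ Tr-* μ))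
  ℛ₁-image = characterisation κ (proj₁ κ∈H) left {ℛ₁} (λ S → mk⇔ (λ x → x) (λ x → x)) (proj₁ (proj₂ κ∈H))

  -- The members of `ℛ₂` are the `f`-images of right families. Right families are adjoints of left
  -- ones, so the same sets are `g`-images of left families, which is the form required for the
  -- second spread.
  ℛ₂-image : ∀ S → S ∈ ℛ₂ ⇔ (∃[ μ ] NonZero μ × S ≐ Image g (λ a → tᴱ a ∘ᴱ Tr-* μ))
  ℛ₂-image S = mk⇔
    (λ S∈ → let μ , μ≉0 , S≐ = Equivalence.to (char S) S∈ in μ , μ≉0 , ≐-trans S≐ (f≐g μ))
    (λ (μ , μ≉0 , S≐) → Equivalence.from (char S) (μ , μ≉0 , ≐-trans S≐ (≐-sym (f≐g μ))))
    where
    char = characterisation κ (proj₁ κ∈H) right {ℛ₂} (λ S → mk⇔ (λ x → x) (λ x → x)) (proj₂ (proj₂ κ∈H))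
    f≐g : ∀ μ → Image f (Family.map (right μ)) ≐ Image g (λ a → tᴱ a ∘ᴱ Tr-* μ)
    f≐g μ = Image-cong f g {Family.map (right μ)} {λ a → tᴱ a ∘ᴱ Tr-* μ}
      (λ a → f.to-cong (𝔼.≈ᴹ-sym {adjoint (tᴱ a ∘ᴱ Tr-* μ)} {Family.map (right μ) a} (adjoint-left μ a)))

  t-nonzero : ∀ {a} → NonZero a → ¬ tᴱ a 𝔼.≈ᴹ 0ᴱ
  t-nonzero a≉0 p = a≉0 (trans (sym (*-identityʳ _)) (p 1#))

  open Conjugation f adjoint-automorphism public
    renaming (conjugate to Φ) using (conjugate-involutive; conjugate-fixes; fixed⇒eigenvector)

  module _ {X : PointSet} (X≐ : X ≐ κ ⟦ ℐ ⟧) where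

    X≐image : X ≐ Image f tᴱ
    X≐image = ≐-trans X≐ (image-family κ (proj₁ κ∈H) diagonal)

    X∈𝒟₁ : X ∈ members 𝒟₁.𝒟
    X∈𝒟₁ = 𝒟₁.∈members {X} {tᴱ 1#} (t-nonzero (FF.0≉1 ∘ sym)) (≐-trans X≐image
      (Image-cong f f {tᴱ} {λ a → tᴱ a ∘ᴱ tᴱ 1#} (λ a → f.to-cong λ x → *-congˡ (sym (*-identityˡ x)))))

    X∈𝒟₂ : X ∈ members 𝒟₂.𝒟
    X∈𝒟₂ = 𝒟₂.∈members {X} {tᴱ 1#} (t-nonzero (FF.0≉1 ∘ sym)) (≐-trans X≐image
      -- Since `adjoint` fixes every `tᴱ a`, the maps `f` and `g` agree on the line of the identity.
      (Image-cong f g {tᴱ} {λ a → tᴱ a ∘ᴱ tᴱ 1#} (λ a → f.to-cong λ x →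
        sym (trans (adjoint-∘ (tᴱ a) (tᴱ 1#) x) (trans (adjoint-t 1# _) (trans (*-identityˡ _) (adjoint-t a x)))))))

    Φ-fixes-X : ∀ p → p ∈ X → Isomorphism.to Φ p ∼ p
    Φ-fixes-X p p∈X = let a , q = proj₁ X≐image {p} p∈X in conjugate-fixes p {tᴱ a} (adjoint-t a) q

  Φ-swaps : MapsFamily Φ (members 𝒟₁.𝒟) (members 𝒟₂.𝒟)
  -- By definition `Φ` is the collineation of `g ∘ᴬ inverse f`, the canonical map between the
  -- structures transported along `f` and `g`.
  Φ-swaps = Transports.maps-lines ext 2≤n 𝔼 standard f g

  -- The adjoint of Tr ∘ t α is t α ∘ Tr, which is not proportional to it when α is not a scalar.
  Φ-order : HasOrder Φ 2
  Φ-order = s≤s z≤n , conjugate-involutive adjoint-involutive , nontrivial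
    where
    α : Carrier
    α = proj₁ nonscalar

    α≉0 : NonZero α
    α≉0 α≈0 = proj₂ nonscalar K.0# (trans α≈0 (sym ι.0#-homo))

    image≉0 : ¬ f.to (Tr-* α) 𝔼.≈ᴹ 0ᴱ
    image≉0 = f.to-nonzero (Tr-*-nonzero α≉0)

    not-proportional : ∀ c → ¬ (∀ x → α * Tr x ≈ ι c * Tr (α * x))
    not-proportional c eq = proj₂ nonscalar _ (trans α≈ (sym (ι.*-homo s (c K.* tr (α * x)))))
      where
      open SetoidReasoning setoid
      x = proj₁ Tr-nonzero
      s⁻¹ : ∃[ s ] s K.* tr x K.≈ K.1#
      s⁻¹ = FK.inverse λ tr≈0 → proj₂ Tr-nonzero (trans (Tr≈ι-tr x) (trans (ι.⟦⟧-cong tr≈0) ι.0#-homo))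
      s = proj₁ s⁻¹
      -- Since `Tr x` is a nonzero scalar, dividing the relation by it exhibits `α` as an element of
      -- `ι 𝕂`.
      α≈ : α ≈ ι s * ι (c K.* tr (α * x))
      α≈ = begin
        α                               ≈⟨ *-identityʳ α ⟨
        α * 1#                          ≈⟨ *-congˡ (trans (ι.⟦⟧-cong (proj₂ s⁻¹)) ι.1#-homo) ⟨
        α * ι (s K.* tr x)              ≈⟨ *-congˡ (ι.*-homo s (tr x)) ⟩
        α * (ι s * ι (tr x))            ≈⟨ *-⋆-comm α s _ ⟩
        ι s * (α * ι (tr x))            ≈⟨ *-congˡ (*-congˡ (Tr≈ι-tr x)) ⟨
        ι s * (α * Tr x)                ≈⟨ *-congˡ (eq x) ⟩
        ι s * (ι c * Tr (α * x))        ≈⟨ *-congˡ (*-congˡ (Tr≈ι-tr (α * x))) ⟩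
        ι s * (ι c * ι (tr (α * x)))    ≈⟨ *-congˡ (ι.*-homo c (tr (α * x))) ⟨
        ι s * ι (c K.* tr (α * x))      ∎

    nontrivial : ∀ k → 0 < k → k < 2 → ¬ PowerIsIdentity Φ k
    nontrivial (suc zero) _ _ identity =
      let c , eq = fixed⇒eigenvector {Tr-* α} image≉0 (identity (f.to (Tr-* α) , image≉0)) in
      not-proportional c (λ x → trans (sym (adjoint-Tr-* α x)) (eq x))
    nontrivial (suc (suc k)) _ (s≤s (s≤s ()))

theorem5p2 : {ℓ : Level} {q n : ℕ} (ext : FiniteFieldExtension ℓ q n) → 2 ≤ n →
    let open Endomorphisms ext in
    (X : PointSet) → Is𝒟-Subspace X →
    Σ[ 𝒟₁ ∈ DesarguesianSpread ] Σ[ 𝒟₂ ∈ DesarguesianSpread ]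
    (X ∈ members 𝒟₁ × ℛ₁ ⊆ members 𝒟₁) ×
    (X ∈ members 𝒟₂ × ℛ₂ ⊆ members 𝒟₂) ×
    ((Σ[ Ξ₁ ∈ Collineation PG ] InducesSemilinearFixing 𝒟₁ ℛ₁ Ξ₁) ×
    IsProjectiveSpace 𝒟₁ × IsSubgeometry 𝒟₁ ℛ₁) ×
    ((Σ[ Ξ₂ ∈ Collineation PG ] InducesSemilinearFixing 𝒟₂ ℛ₂ Ξ₂) ×
    IsProjectiveSpace 𝒟₂ × IsSubgeometry 𝒟₂ ℛ₂) ×
    (Σ[ Φ ∈ Collineation PG ]
    HasOrder Φ 2 ×
    (∀ p → p ∈ X → Isomorphism.to Φ p ∼ p) ×
    MapsFamily Φ (members 𝒟₁) (members 𝒟₂))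
theorem5p2 ext 2≤n X (κ , κ∈H , X≐) =
  𝒟₁.𝒟 , 𝒟₂.𝒟 ,
  (X∈𝒟₁ X≐ , 𝒟₁.⊆members ℛ₁ ℛ₁-image) ,
  (X∈𝒟₂ X≐ , 𝒟₂.⊆members ℛ₂ ℛ₂-image) ,
  (𝒟₁.inducesSemilinearFixing ℛ₁ ℛ₁-image , 𝒟₁.isProjectiveSpace , 𝒟₁.isSubgeometry ℛ₁ ℛ₁-image) ,
  (𝒟₂.inducesSemilinearFixing ℛ₂ ℛ₂-image , 𝒟₂.isProjectiveSpace , 𝒟₂.isSubgeometry ℛ₂ ℛ₂-image) ,
  (Φ , Φ-order , Φ-fixes-X X≐ , Φ-swaps)
  where
  open Endomorphisms ext
  open Construction ext 2≤n κ κ∈H
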